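{- Let $G$ be a simple graph of order $n$ and let $\alpha\ge2$ be an integer. If $\lambda(G)\le\frac{n}{\alpha}$, then $$i_\alpha(G)\ge\left(\frac{1}{\alpha(\alpha-1)}-\frac{1}{n}\right)\frac{(\alpha-1)(\alpha-2)}{\alpha}\left(\frac{n}{\alpha-1}\right)^{\alpha}.$$
   Context: $\lambda(G)$ is the spectral radius of the adjacency matrix of $G$. For a positive integer $s$, $i_s(G)$ denotes the number of independent sets of size $s$ in $G$. -}

module Defs where

open import Algebra.Apartness.Bundles using (HeytingField)
import Algebra.Definitions.RawMonoid as RawMonoidOps
import Algebra.Definitions.RawSemiring as RawSemiringOps
open import Algebra.Properties.CommutativeMonoid.Sum using (sum)
open import Algebra.Bundles using (CommutativeRing)
open import Data.Bool.Base using (if_then_else_)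
open import Data.Fin.Base using (Fin)
open import Data.Fin.Properties using (all?)
open import Data.Fin.Subset using (Subset; inside; outside; _∈_; ∣_∣)
open import Data.Fin.Subset.Properties using (_∈?_)
open import Data.Integer.Base using (+_)
open import Data.List.Base using (List; []; _∷_; _++_; map; filter; length)
open import Data.Nat.Base as ℕ using (ℕ; zero; suc; NonZero; s≤s; z≤n)
import Data.Nat.Properties as ℕₚ
open import Data.Product.Base using (∃-syntax; _×_; proj₁)
open import Data.Rational.Base as ℚ using (ℚ; _/_)
open import Data.Sum.Base using (_⊎_)
open import Data.Vec.Base using ([]; _∷_)
open import Level using (_⊔_; 0ℓ) renaming (suc to lsuc)
open import Relation.Binary.Core using (Rel)
open import Relation.Binary.Definitions using (Decidable; Symmetric; Irreflexive)
open import Relation.Binary.PropositionalEquality.Core using (_≡_)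
open import Relation.Binary.Structures using (IsStrictPartialOrder)
open import Relation.Nullary.Decidable.Core using (Dec; does; _×-dec_; _→-dec_; ¬?)
open import Relation.Nullary.Negation.Core using (¬_)

-- The real numbers, characterised up to isomorphism as a Cauchy-complete
-- Archimedean ordered field.  Decidability of the order is not required, so the
-- axioms hold both for the classical reals and for constructive models such as
-- regular sequences of rationals.

record RealField c ℓ₁ ℓ₂ ℓ₃ : Set (lsuc (c ⊔ ℓ₁ ⊔ ℓ₂ ⊔ ℓ₃)) where
  infix 4 _<_ _≤_
  infixl 7 _÷_

  field
    heytingField : HeytingField c ℓ₁ ℓ₂

  open HeytingField heytingField public

  commutativeRing : CommutativeRing c ℓ₁
  commutativeRing = record { isCommutativeRing = isCommutativeRing }

  field
    _<_                  : Rel Carrier ℓ₃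
    isStrictPartialOrder : IsStrictPartialOrder _≈_ _<_
    <⇒#                  : ∀ {x y} → x < y → x # y
    #⇒<⊎>                : ∀ {x y} → x # y → x < y ⊎ y < x
    0<1                  : 0# < 1#
    +-monoʳ-<            : ∀ z {x y} → x < y → z + x < z + y
    *-pos                : ∀ {x y} → 0# < x → 0# < y → 0# < x * y

  _≤_ : Rel Carrier ℓ₃
  x ≤ y = ¬ (y < x)

  fromℕ : ℕ → Carrier
  fromℕ n = RawMonoidOps._×_ (CommutativeRing.+-rawMonoid commutativeRing) n 1#

  field
    archimedean : ∀ x → ∃[ n ] x < fromℕ n
    complete    : (s : ℕ → Carrier) →
                  (∀ ε → 0# < ε → ∃[ N ] (∀ i j → N ℕ.≤ i → N ℕ.≤ j → s i < s j + ε)) →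
                  ∃[ l ] (∀ ε → 0# < ε →
                    ∃[ N ] (∀ i → N ℕ.≤ i → (s i < l + ε) × (l < s i + ε)))

  private module < = IsStrictPartialOrder isStrictPartialOrder

  0<fromℕ[1+n] : ∀ n → 0# < fromℕ (suc n)
  0<fromℕ[1+n] zero    = <.<-respʳ-≈ (sym (+-identityʳ 1#)) 0<1
  0<fromℕ[1+n] (suc n) = <.trans 0<1
    (<.<-respˡ-≈ (+-identityʳ 1#) (+-monoʳ-< 1# (0<fromℕ[1+n] n)))

  -- `#⇒invertible` inverts the difference `fromℕ (suc d) - 0#`.
  _÷_ : (m d : ℕ) .{{_ : NonZero d}} → Carrier
  m ÷ suc d = fromℕ m * proj₁ (#⇒invertible (#-sym (<⇒# (0<fromℕ[1+n] d))))

record SimpleGraph (n : ℕ) : Set₁ where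
  infix 4 _∼_ _∼?_
  field
    _∼_      : Rel (Fin n) 0ℓ
    _∼?_     : Decidable _∼_
    ∼-sym    : Symmetric _∼_
    ∼-irrefl : Irreflexive _≡_ _∼_

module _ {c ℓ₁ ℓ₂ ℓ₃} (ℝ : RealField c ℓ₁ ℓ₂ ℓ₃) where
  open RealField ℝ

  Vector : ℕ → Set c
  Vector n = Fin n → Carrier

  Matrix : ℕ → Set c
  Matrix n = Fin n → Fin n → Carrier

  mulVec : ∀ {n} → Matrix n → Vector n → Vector n
  mulVec A v i = sum (CommutativeRing.+-commutativeMonoid commutativeRing) (λ j → A i j * v j)

  -- The complex number a + bi is an eigenvalue of the real matrix A; the
  -- eigenvector is u + vi, and A (u + vi) = (a + bi)(u + vi) is split into its
  -- real and imaginary parts.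
  IsEigenvalue : ∀ {n} → Matrix n → (a b : Carrier) → Set (c ⊔ ℓ₁ ⊔ ℓ₂)
  IsEigenvalue {n} A a b = ∃[ u ] ∃[ v ]
    (∃[ i ] (u i # 0# ⊎ v i # 0#)) ×
    (∀ (i : Fin n) → mulVec A u i ≈ a * u i - b * v i) ×
    (∀ (i : Fin n) → mulVec A v i ≈ a * v i + b * u i)

  -- The largest modulus of a complex eigenvalue; since 0 ≤ ρ, moduli are
  -- compared with ρ through their squares a² + b².
  IsSpectralRadius : ∀ {n} → Matrix n → Carrier → Set (c ⊔ ℓ₁ ⊔ ℓ₂ ⊔ ℓ₃)
  IsSpectralRadius A ρ =
    0# ≤ ρ ×
    (∃[ a ] ∃[ b ] (IsEigenvalue A a b × a * a + b * b ≈ ρ * ρ)) ×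
    (∀ a b → IsEigenvalue A a b → a * a + b * b ≤ ρ * ρ)

  adjacencyMatrix : ∀ {n} → SimpleGraph n → Matrix n
  adjacencyMatrix G i j = if does (i ∼? j) then 1# else 0#
    where open SimpleGraph G

subsets : ∀ n → List (Subset n)
subsets zero    = [] ∷ []
subsets (suc n) = map (outside ∷_) (subsets n) ++ map (inside ∷_) (subsets n)

module _ {n : ℕ} (G : SimpleGraph n) where
  open SimpleGraph G

  Independent : Subset n → Set
  Independent S = ∀ x → x ∈ S → ∀ y → y ∈ S → ¬ (x ∼ y)

  independent? : (S : Subset n) → Dec (Independent S)
  independent? S =
    all? λ x → (x ∈? S) →-dec all? λ y → (y ∈? S) →-dec ¬? (x ∼? y)

  independentSetCount : ℕ → ℕ
  independentSetCount s =
    length (filter (λ S → independent? S ×-dec (∣ S ∣ ℕₚ.≟ s)) (subsets n))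

open RawSemiringOps ℚ.+-*-rawSemiring public using () renaming (_^_ to _^ℚ_)

2≤α⇒α≢0 : ∀ {α} → 2 ℕ.≤ α → NonZero α
2≤α⇒α≢0 (s≤s _) = _

2≤α⇒α∸1≢0 : ∀ {α} → 2 ℕ.≤ α → NonZero (α ℕ.∸ 1)
2≤α⇒α∸1≢0 (s≤s (s≤s _)) = _

lowerBound : (n α : ℕ) .{{_ : NonZero n}} → 2 ℕ.≤ α → ℚ
lowerBound n α 2≤α =
  ((+ 1 / (α ℕ.* (α ℕ.∸ 1))) ℚ.- (+ 1 / n))
    ℚ.* (+ ((α ℕ.∸ 1) ℕ.* (α ℕ.∸ 2)) / α)
    ℚ.* ((+ n / (α ℕ.∸ 1)) ^ℚ α)
  where
  instance
    α≢0 : NonZero α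
    α≢0 = 2≤α⇒α≢0 2≤α
    α∸1≢0 : NonZero (α ℕ.∸ 1)
    α∸1≢0 = 2≤α⇒α∸1≢0 2≤α
    α[α∸1]≢0 : NonZero (α ℕ.* (α ℕ.∸ 1))
    α[α∸1]≢0 = ℕₚ.m*n≢0 α (α ℕ.∸ 1)

{-# OPTIONS --safe #-}

-- Write E for the degree sum of G and A for its adjacency matrix.
--
-- Spectral part: E / n is the Rayleigh quotient of A at the all-ones vector, so λ(G) ≤ n / α
-- gives α E ≤ n² once A is known to have an eigenvalue at least E / n.  The order on the reals
-- being undecidable, the largest eigenvalue is built as the limit of rationals p / u, where p is
-- maximal such that p I − u A is not positive definite, a decidable property of an integer matrix.
-- That it is an eigenvalue is only needed, and only proved, up to double negation.
--
-- Counting part: writing k s for the number of independent s-sets, a double count and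
-- Cauchy–Schwarz give the Moon–Moser inequalities
-- (s + 1)² k(s + 1)² ≤ k(s) (n k(s + 1) + s (s + 2) k(s + 2)).
-- Starting from 2 k(2) ≥ n² − n − E, they bound every ratio k(s + 1) / k(s) from below, and the
-- product of these bounds for s < α exceeds the claimed bound unless n < α (α − 1), when the
-- latter is not positive.

module Submission where

open import Defs
open import Algebra.Bundles using (CommutativeRing; RawRing)
import Algebra.Apartness.Properties.HeytingCommutativeRing as Apartness
import Algebra.Properties.CommutativeMonoid.Sum as MonoidSum
import Algebra.Properties.Ring as RingProperties
import Algebra.Properties.Semiring.Mult as Mult
import Algebra.Properties.Semiring.Mult.TCOptimised as Mult′
import Algebra.Properties.Semiring.Sum as SemiringSum
import Algebra.Solver.CommutativeMonoid as MonoidSolver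
import Algebra.Solver.Ring as RingSolver
open import Algebra.Solver.Ring.AlmostCommutativeRing
  using (fromCommutativeRing; _-Raw-AlmostCommutative⟶_)
open import Data.Bool.Base using (true; false; if_then_else_)
open import Data.Empty using (⊥; ⊥-elim)
open import Data.Fin.Base using (Fin; zero; suc)
open import Data.Fin.Subset using (Subset; inside; outside; _∈_; _∉_; ∣_∣; ∁)
open import Data.List.Base as List using (List; []; _∷_; map; filter; length)
open import Data.List.Properties using (filter-++; length-++)
open import Data.Maybe.Base using (Maybe; just; nothing)
open import Data.Nat.Base as ℕ using (ℕ; zero; suc; NonZero)
import Data.Nat.Properties as ℕ
open import Data.Nat.Tactic.RingSolver using (solve-∀)
open import Data.Product.Base using (_×_; _,_; proj₁; proj₂; ∃-syntax)
open import Data.Sum.Base using (_⊎_; inj₁; inj₂; [_,_]′)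
open import Data.Unit.Polymorphic.Base using (⊤)
open import Data.Vec.Base using ([]; _∷_; _[_]≔_; here; there)
open import Data.Vec.Functional using () renaming (_∷_ to _◂_)
open import Data.Vec.Properties using ([]≔-updates)
open import Function.Base using (_∘_)
open import Level using (0ℓ)
open import Relation.Binary.Definitions using (tri<; tri≈; tri>)
import Relation.Binary.PropositionalEquality as ≡
open ≡ using (_≡_)
import Relation.Binary.Reasoning.Setoid as ≈-Reasoning
open import Relation.Binary.Structures using (IsStrictPartialOrder)
open import Relation.Nullary.Decidable.Core using (Dec; does; yes; no; ¬?; _×-dec_)
open import Relation.Nullary.Negation.Core using (¬_; contradiction)

-- What ties `ρ` to the graph is that no eigenvalue exceeds it in modulus, so if the degree sum were
-- too large, an eigenvalue beating `ρ` would have to be produced. Double negation is enough for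
-- this: `≤` on the reals is itself a negation, and the inequality to be derived, between naturals,
-- is decidable. Definiteness is tested by symmetric elimination, which reads the signs of
-- successive pivots. For integer matrices these signs are computed; for λ I - A at the limit λ the
-- same elimination runs with result ⊥.
--
-- In the counting part put r = α - 1. For n ≥ α r one has 1 + n / α ≤ n / r, which simplifies the
-- ratio bound to k(s + 1) / k(s) ≥ n (r - s) / (r (s + 1)); the product over s < r is k(r) ≥ (n /
-- r)^r. At s = r the simplified bound would be 0, so the last ratio uses the unsimplified one,
-- which contributes (n - α r) / α². For α > 2 the outcome beats the claim by the factor (α - 1) /
-- (α - 2), given away when denominators are cleared.

module ℕSum = MonoidSum ℕ.+-0-commutativeMonoid

-- Arithmetic and order in a constructive ordered field.

module OrderedField {c ℓ₁ ℓ₂ ℓ₃} (ℝ : RealField c ℓ₁ ℓ₂ ℓ₃) where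
  open RealField ℝ
  private
    module R = CommutativeRing commutativeRing
    module < = IsStrictPartialOrder isStrictPartialOrder
    module HCR = Apartness heytingCommutativeRing
  open Mult R.semiring using (×-homo-+; ×1-homo-*)
  open Mult′ R.semiring using (×ᵤ≈×) renaming (_×_ to _×′_)

  -- Integers for the ring solver, as normalised differences a − b of naturals.
  Coeff : Set
  Coeff = ℕ × ℕ

  difference : Coeff → Carrier
  difference (a , b) = fromℕ a - fromℕ b

  normalise : Coeff → Coeff
  normalise (a , b) = a ℕ.∸ b , b ℕ.∸ a

  -- The optimised multiple in the first clause makes `con (0 , 0)` and `con (1 , 0)` evaluate to
  -- `0#` and `1#` definitionally, whereas `fromℕ 1` is `1# + 0#`.
  ⟦_⟧ : Coeff → Carrier
  ⟦ a , zero ⟧      = a ×′ 1#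
  ⟦ a , b@(suc _) ⟧ = difference (a , b)

  coeffRing : RawRing _ _
  coeffRing = record
    { Carrier = Coeff
    ; _≈_     = _≡_
    ; _+_     = λ (a , b) (c , d) → normalise (a ℕ.+ c , b ℕ.+ d)
    ; _*_     = λ (a , b) (c , d) → normalise (a ℕ.* c ℕ.+ b ℕ.* d , a ℕ.* d ℕ.+ b ℕ.* c)
    ; -_      = λ (a , b) → b , a
    ; 0#      = 0 , 0
    ; 1#      = 1 , 0
    }

  open RingProperties R.ring
    using (-0#≈0#; -‿distribˡ-*; -‿distribʳ-*; -‿+-comm; -‿involutive)

  fromℕ-+ : ∀ a b → fromℕ (a ℕ.+ b) ≈ fromℕ a + fromℕ b
  fromℕ-+ = ×-homo-+ 1#

  fromℕ-* : ∀ a b → fromℕ (a ℕ.* b) ≈ fromℕ a * fromℕ b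
  fromℕ-* = ×1-homo-*

  private
    module Simple = MonoidSolver R.+-commutativeMonoid

  difference-cong : ∀ a b c d → a ℕ.+ d ≡ c ℕ.+ b → difference (a , b) ≈ difference (c , d)
  difference-cong a b c d a+d≡c+b = begin
    fromℕ a - fromℕ b                             ≈⟨ +-identityʳ _ ⟨
    fromℕ a - fromℕ b + 0#                        ≈⟨ +-congˡ (-‿inverseʳ (fromℕ d)) ⟨
    fromℕ a - fromℕ b + (fromℕ d - fromℕ d)       ≈⟨ Simple.solve 4 (λ x y z w →
      ((x Simple.⊕ y) Simple.⊕ (z Simple.⊕ w)) Simple.⊜ ((x Simple.⊕ z) Simple.⊕ (y Simple.⊕ w)))
      refl (fromℕ a) (- fromℕ b) (fromℕ d) (- fromℕ d) ⟩
    (fromℕ a + fromℕ d) + (- fromℕ b - fromℕ d)   ≈⟨ +-congʳ (fromℕ-+ a d) ⟨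
    fromℕ (a ℕ.+ d) + (- fromℕ b - fromℕ d)       ≡⟨ ≡.cong (λ m → fromℕ m + (- fromℕ b - fromℕ d)) a+d≡c+b ⟩
    fromℕ (c ℕ.+ b) + (- fromℕ b - fromℕ d)       ≈⟨ +-congʳ (fromℕ-+ c b) ⟩
    (fromℕ c + fromℕ b) + (- fromℕ b - fromℕ d)   ≈⟨ Simple.solve 4 (λ x y z w →
      ((x Simple.⊕ y) Simple.⊕ (z Simple.⊕ w)) Simple.⊜ ((x Simple.⊕ w) Simple.⊕ (y Simple.⊕ z)))
      refl (fromℕ c) (fromℕ b) (- fromℕ b) (- fromℕ d) ⟩
    fromℕ c - fromℕ d + (fromℕ b - fromℕ b)       ≈⟨ +-congˡ (-‿inverseʳ (fromℕ b)) ⟩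
    fromℕ c - fromℕ d + 0#                        ≈⟨ +-identityʳ _ ⟩
    fromℕ c - fromℕ d                             ∎
    where open ≈-Reasoning R.setoid

  ⟦⟧≈difference : ∀ x → ⟦ x ⟧ ≈ difference x
  ⟦⟧≈difference (a , zero)  = sym (trans (+-congˡ -0#≈0#) (trans (+-identityʳ _) (×ᵤ≈× a 1#)))
  ⟦⟧≈difference (a , suc b) = refl

  difference-normalise : ∀ x → difference (normalise x) ≈ difference x
  difference-normalise (a , b) = difference-cong (a ℕ.∸ b) (b ℕ.∸ a) a b
    (≡.trans (ℕ.+-comm (a ℕ.∸ b) b) (monus-comm b a))
    where
    monus-comm : ∀ m n → m ℕ.+ (n ℕ.∸ m) ≡ n ℕ.+ (m ℕ.∸ n)
    monus-comm zero    zero    = ≡.refl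
    monus-comm zero    (suc n) = ≡.sym (ℕ.+-identityʳ (suc n))
    monus-comm (suc m) zero    = ℕ.+-identityʳ (suc m)
    monus-comm (suc m) (suc n) = ≡.cong suc (monus-comm m n)

  ⟦normalise⟧ : ∀ x → ⟦ normalise x ⟧ ≈ difference x
  ⟦normalise⟧ x = trans (⟦⟧≈difference (normalise x)) (difference-normalise x)

  private
    module C = RawRing coeffRing

  ⟦⟧-+ : ∀ x y → ⟦ x C.+ y ⟧ ≈ ⟦ x ⟧ + ⟦ y ⟧
  ⟦⟧-+ x@(a , b) y@(c , d) = begin
    ⟦ normalise (a ℕ.+ c , b ℕ.+ d) ⟧                 ≈⟨ ⟦normalise⟧ (a ℕ.+ c , b ℕ.+ d) ⟩
    fromℕ (a ℕ.+ c) - fromℕ (b ℕ.+ d)                 ≈⟨ +-cong (fromℕ-+ a c) (-‿cong (fromℕ-+ b d)) ⟩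
    (fromℕ a + fromℕ c) - (fromℕ b + fromℕ d)         ≈⟨ +-congˡ (-‿+-comm (fromℕ b) (fromℕ d)) ⟨
    (fromℕ a + fromℕ c) + (- fromℕ b - fromℕ d)       ≈⟨ Simple.solve 4 (λ x y z w →
      ((x Simple.⊕ y) Simple.⊕ (z Simple.⊕ w)) Simple.⊜ ((x Simple.⊕ z) Simple.⊕ (y Simple.⊕ w)))
      refl (fromℕ a) (fromℕ c) (- fromℕ b) (- fromℕ d) ⟩
    difference x + difference y                       ≈⟨ +-cong (⟦⟧≈difference x) (⟦⟧≈difference y) ⟨
    ⟦ x ⟧ + ⟦ y ⟧                                     ∎
    where open ≈-Reasoning R.setoid

  ⟦⟧-* : ∀ x y → ⟦ x C.* y ⟧ ≈ ⟦ x ⟧ * ⟦ y ⟧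
  ⟦⟧-* x@(a , b) y@(c , d) = begin
    ⟦ x C.* y ⟧
      ≈⟨ ⟦normalise⟧ (a ℕ.* c ℕ.+ b ℕ.* d , a ℕ.* d ℕ.+ b ℕ.* c) ⟩
    fromℕ (a ℕ.* c ℕ.+ b ℕ.* d) - fromℕ (a ℕ.* d ℕ.+ b ℕ.* c)
      ≈⟨ +-cong (sum-of-products a c b d) (-‿cong (sum-of-products a d b c)) ⟩
    (fa * fc + fb * fd) - (fa * fd + fb * fc)
      ≈⟨ +-congˡ (-‿+-comm (fa * fd) (fb * fc)) ⟨
    (fa * fc + fb * fd) + (- (fa * fd) - fb * fc)
      ≈⟨ +-cong (+-congˡ (sym (trans (sym (-‿distribˡ-* fb (- fd)))
           (trans (-‿cong (sym (-‿distribʳ-* fb fd))) (-‿involutive _)))))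
           (+-cong (-‿distribʳ-* fa fd) (-‿distribˡ-* fb fc)) ⟩
    (fa * fc + (- fb) * (- fd)) + (fa * (- fd) + (- fb) * fc)
      ≈⟨ Simple.solve 4 (λ x y z w →
      ((x Simple.⊕ y) Simple.⊕ (z Simple.⊕ w)) Simple.⊜ ((x Simple.⊕ z) Simple.⊕ (w Simple.⊕ y)))
      refl (fa * fc) ((- fb) * (- fd)) (fa * (- fd)) ((- fb) * fc) ⟩
    (fa * fc + fa * (- fd)) + ((- fb) * fc + (- fb) * (- fd))
      ≈⟨ +-cong (distribˡ fa fc (- fd)) (distribˡ (- fb) fc (- fd)) ⟨
    fa * (fc - fd) + (- fb) * (fc - fd)
      ≈⟨ distribʳ (fc - fd) fa (- fb) ⟨
    difference x * difference y
      ≈⟨ *-cong (⟦⟧≈difference x) (⟦⟧≈difference y) ⟨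
    ⟦ x ⟧ * ⟦ y ⟧ ∎
    where
    open ≈-Reasoning R.setoid
    fa = fromℕ a
    fb = fromℕ b
    fc = fromℕ c
    fd = fromℕ d
    sum-of-products : ∀ a b c d → fromℕ (a ℕ.* b ℕ.+ c ℕ.* d) ≈ fromℕ a * fromℕ b + fromℕ c * fromℕ d
    sum-of-products a b c d = trans (fromℕ-+ (a ℕ.* b) (c ℕ.* d)) (+-cong (fromℕ-* a b) (fromℕ-* c d))

  ⟦⟧-neg : ∀ x → ⟦ C.- x ⟧ ≈ - ⟦ x ⟧
  ⟦⟧-neg x@(a , b) = begin
    ⟦ b , a ⟧               ≈⟨ ⟦⟧≈difference (b , a) ⟩
    fromℕ b - fromℕ a       ≈⟨ +-congʳ (-‿involutive (fromℕ b)) ⟨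
    - (- fromℕ b) - fromℕ a ≈⟨ +-comm _ _ ⟩
    - fromℕ a - - fromℕ b   ≈⟨ -‿+-comm (fromℕ a) (- fromℕ b) ⟩
    - difference x          ≈⟨ -‿cong (⟦⟧≈difference x) ⟨
    - ⟦ x ⟧                 ∎
    where open ≈-Reasoning R.setoid

  ⟦⟧-morphism : coeffRing -Raw-AlmostCommutative⟶ fromCommutativeRing commutativeRing
  ⟦⟧-morphism = record
    { ⟦_⟧    = ⟦_⟧
    ; +-homo = ⟦⟧-+
    ; *-homo = ⟦⟧-*
    ; -‿homo = ⟦⟧-neg
    ; 0-homo = refl
    ; 1-homo = refl
    }

  _coeff≟_ : (x y : Coeff) → Maybe (⟦ x ⟧ ≈ ⟦ y ⟧)
  (a , b) coeff≟ (c , d) with a ℕ.≟ c | b ℕ.≟ d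
  ... | yes ≡.refl | yes ≡.refl = just refl
  ... | _          | _          = nothing

  open RingSolver coeffRing (fromCommutativeRing commutativeRing) ⟦⟧-morphism _coeff≟_
    public using (solve; con; _:=_; _:+_; _:*_; _:-_; :-_)

  <-trans : ∀ {x y z} → x < y → y < z → x < z
  <-trans = <.trans

  <-irrefl : ∀ {x} → ¬ (x < x)
  <-irrefl = <.irrefl refl

  <-resp : ∀ {x x′ y y′} → x ≈ x′ → y ≈ y′ → x < y → x′ < y′
  <-resp x≈x′ y≈y′ x<y = <.<-respˡ-≈ x≈x′ (<.<-respʳ-≈ y≈y′ x<y)

  -- The constructive substitute for totality: a strict inequality leaves a gap, and any z is on the
  -- right side of one of its ends.
  <-cotrans : ∀ {x y} → x < y → ∀ z → x < z ⊎ z < y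
  <-cotrans x<y z with #-cotrans (<⇒# x<y) z
  ... | inj₁ x#z with #⇒<⊎> x#z
  ...   | inj₁ x<z = inj₁ x<z
  ...   | inj₂ z<x = inj₂ (<-trans z<x x<y)
  <-cotrans x<y z | inj₂ z#y with #⇒<⊎> z#y
  ... | inj₁ z<y = inj₂ z<y
  ... | inj₂ y<z = inj₁ (<-trans x<y y<z)

  <-≤-trans : ∀ {x y z} → x < y → y ≤ z → x < z
  <-≤-trans {z = z} x<y y≤z with <-cotrans x<y z
  ... | inj₁ x<z = x<z
  ... | inj₂ z<y = contradiction z<y y≤z

  <⇒≤ : ∀ {x y} → x < y → x ≤ y
  <⇒≤ x<y y<x = <-irrefl (<-trans x<y y<x)

  ≤-resp : ∀ {x x′ y y′} → x ≈ x′ → y ≈ y′ → x ≤ y → x′ ≤ y′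
  ≤-resp x≈x′ y≈y′ x≤y y′<x′ = x≤y (<-resp (sym y≈y′) (sym x≈x′) y′<x′)

  ≤-reflexive : ∀ {x y} → x ≈ y → x ≤ y
  ≤-reflexive x≈y y<x = <.irrefl (sym x≈y) y<x

  +-monoˡ-< : ∀ z {x y} → x < y → x + z < y + z
  +-monoˡ-< z x<y = <-resp (+-comm z _) (+-comm z _) (+-monoʳ-< z x<y)

  +-cancelˡ-< : ∀ z {x y} → z + x < z + y → x < y
  +-cancelˡ-< z {x} {y} p = <-resp (cancel z x) (cancel z y) (+-monoʳ-< (- z) p)
    where
    cancel : ∀ z x → - z + (z + x) ≈ x
    cancel = solve 2 (λ z x → :- z :+ (z :+ x) := x) refl

  <⇒0<- : ∀ {x y} → x < y → 0# < y - x
  <⇒0<- {x} x<y = <.<-respˡ-≈ (-‿inverseʳ x) (+-monoˡ-< (- x) x<y)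

  0<-⇒< : ∀ {x y} → 0# < y - x → x < y
  0<-⇒< {x} {y} p = <-resp (+-identityʳ x) (solve 2 (λ x y → x :+ (y :- x) := y) refl x y) (+-monoʳ-< x p)

  ≤⇒0≤- : ∀ {x y} → x ≤ y → 0# ≤ y - x
  ≤⇒0≤- {x} {y} x≤y p = x≤y
    (<-resp (solve 2 (λ x y → x :+ (y :- x) := y) refl x y) (+-identityʳ x) (+-monoʳ-< x p))

  neg-pos : ∀ {x} → x < 0# → 0# < - x
  neg-pos {x} x<0 = <.<-respʳ-≈ (+-identityˡ (- x)) (<⇒0<- x<0)

  -- Tightness of apartness makes trichotomy irrefutable. Since `≤` is a negation, this permits a
  -- case distinction on signs in every proof of a `≤`.
  ¬¬-trichotomy : ∀ x → (x < 0# → ⊥) → (x ≈ 0# → ⊥) → (0# < x → ⊥) → ⊥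
  ¬¬-trichotomy x ≮ ≉ ≯ = ≉ (proj₁ (tight x 0#) λ x#0 → [ ≮ , ≯ ]′ (#⇒<⊎> x#0))

  pos+nonneg : ∀ {x y} → 0# < x → 0# ≤ y → 0# < x + y
  pos+nonneg {x} {y} 0<x 0≤y with <-cotrans 0<x (x + y)
  ... | inj₁ 0<x+y = 0<x+y
  ... | inj₂ x+y<x = contradiction
    (+-cancelˡ-< x (<.<-respʳ-≈ (sym (+-identityʳ x)) x+y<x)) 0≤y

  nonneg+pos : ∀ {x y} → 0# ≤ x → 0# < y → 0# < x + y
  nonneg+pos 0≤x 0<y = <.<-respʳ-≈ (+-comm _ _) (pos+nonneg 0<y 0≤x)

  nonneg+nonneg : ∀ {x y} → 0# ≤ x → 0# ≤ y → 0# ≤ x + y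
  nonneg+nonneg {x} {y} 0≤x 0≤y x+y<0 with <-cotrans x+y<0 x
  ... | inj₁ x+y<x = 0≤y (+-cancelˡ-< x (<.<-respʳ-≈ (sym (+-identityʳ x)) x+y<x))
  ... | inj₂ x<0   = 0≤x x<0

  nonneg*nonneg : ∀ {x y} → 0# ≤ x → 0# ≤ y → 0# ≤ x * y
  nonneg*nonneg {x} {y} 0≤x 0≤y xy<0 = ¬¬-trichotomy x 0≤x
    (λ x≈0 → <.irrefl (trans (*-congʳ x≈0) (R.zeroˡ y)) xy<0)
    (λ 0<x → ¬¬-trichotomy y 0≤y
      (λ y≈0 → <.irrefl (trans (*-congˡ y≈0) (R.zeroʳ x)) xy<0)
      (λ 0<y → <-irrefl (<-trans xy<0 (*-pos 0<x 0<y))))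

  0<x*x : ∀ {x} → x < 0# ⊎ 0# < x → 0# < x * x
  0<x*x (inj₂ 0<x)     = *-pos 0<x 0<x
  0<x*x {x} (inj₁ x<0) = <.<-respʳ-≈ (solve 1 (λ x → :- x :* :- x := x :* x) refl x)
    (*-pos (neg-pos x<0) (neg-pos x<0))

  0≤x*x : ∀ x → 0# ≤ x * x
  0≤x*x x xx<0 = ¬¬-trichotomy x
    (λ x<0 → <-irrefl (<-trans xx<0 (0<x*x (inj₁ x<0))))
    (λ x≈0 → <.irrefl (trans (*-congʳ x≈0) (R.zeroˡ x)) xx<0)
    (λ 0<x → <-irrefl (<-trans xx<0 (0<x*x (inj₂ 0<x))))

  pos*neg : ∀ {x y} → 0# < x → y < 0# → x * y < 0#
  pos*neg {x} {y} 0<x y<0 = 0<-⇒< (<.<-respʳ-≈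
    (solve 2 (λ x y → x :* :- y := con (0 , 0) :- x :* y) refl x y) (*-pos 0<x (neg-pos y<0)))

  *-cancelˡ-nonneg : ∀ {x y} → 0# < x → 0# ≤ x * y → 0# ≤ y
  *-cancelˡ-nonneg 0<x 0≤xy y<0 = 0≤xy (pos*neg 0<x y<0)

  -- Invertibility makes y apart from 0, hence positive or negative, and a negative y would make the
  -- product negative.
  x*y≈1⇒0<y : ∀ {x y} → 0# < x → x * y ≈ 1# → 0# < y
  x*y≈1⇒0<y {x} {y} 0<x x*y≈1 = [ (λ y<0 → ⊥-elim (absurd y<0)) , (λ 0<y → 0<y) ]′ (#⇒<⊎> y#0)
    where
    y#0 : y # 0#
    y#0 = HCR.invertibleˡ⇒# (x , trans (solve 2 (λ x y → x :* (y :- con (0 , 0)) := x :* y) refl x y) x*y≈1)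
    absurd : ¬ (y < 0#)
    absurd y<0 = <-irrefl (<-trans 0<1 (<.<-respˡ-≈ x*y≈1 (pos*neg 0<x y<0)))

  abstract
    inverse : ∀ {x} → 0# < x → ∃[ y ] 0# < y × x * y ≈ 1#
    inverse {x} 0<x = let y , y*[x-0]≈1 , _ = #⇒invertible (#-sym (<⇒# 0<x))
                          x*y≈1 = cancel y y*[x-0]≈1
                      in y , x*y≈1⇒0<y 0<x x*y≈1 , x*y≈1
      where
      cancel : ∀ y → y * (x - 0#) ≈ 1# → x * y ≈ 1#
      cancel y = trans (solve 2 (λ x y → x :* y := y :* (x :- con (0 , 0))) refl x y)

  pos-cancelʳ : ∀ {x y} → 0# < y → 0# < x * y → 0# < x
  pos-cancelʳ {x} {y} 0<y 0<xy = let y⁻¹ , 0<y⁻¹ , yy⁻¹≈1 = inverse 0<y in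
    <.<-respʳ-≈ (trans (*-assoc x y y⁻¹) (trans (*-congˡ yy⁻¹≈1) (*-identityʳ x))) (*-pos 0<xy 0<y⁻¹)

  fromℕ-mono-< : ∀ {a b} → a ℕ.< b → fromℕ a < fromℕ b
  fromℕ-mono-< {zero}  {suc b} _           = 0<fromℕ[1+n] b
  fromℕ-mono-< {suc a} {suc b} (ℕ.s≤s a<b) = +-monoʳ-< 1# (fromℕ-mono-< a<b)

  fromℕ-mono-≤ : ∀ {a b} → a ℕ.≤ b → fromℕ a ≤ fromℕ b
  fromℕ-mono-≤ a≤b with ℕ.m≤n⇒m<n∨m≡n a≤b
  ... | inj₁ a<b    = <⇒≤ (fromℕ-mono-< a<b)
  ... | inj₂ ≡.refl = <-irrefl

  0≤fromℕ : ∀ m → 0# ≤ fromℕ m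
  0≤fromℕ m = fromℕ-mono-≤ {0} {m} ℕ.z≤n

  IsInteger : Carrier → Set ℓ₁
  IsInteger x = ∃[ z ] x ≈ ⟦ z ⟧

  fromℕ-isInteger : ∀ m → IsInteger (fromℕ m)
  fromℕ-isInteger m = (m , 0) , ×ᵤ≈× m 1#

  -- The expression has the shape of the entries of both `schur` and `shift`, so integrality passes
  -- from `A` to every matrix met during elimination.
  isInteger-closed : ∀ {a b c d} → IsInteger a → IsInteger b → IsInteger c → IsInteger d →
    IsInteger (a * b + - c * d)
  isInteger-closed (z , a≈z) (z′ , b≈z′) (w , c≈w) (w′ , d≈w′) = (z C.* z′) C.+ ((C.- w) C.* w′) , (begin
    _ * _ + - _ * _                       ≈⟨ +-cong (*-cong a≈z b≈z′) (*-cong (-‿cong c≈w) d≈w′) ⟩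
    ⟦ z ⟧ * ⟦ z′ ⟧ + - ⟦ w ⟧ * ⟦ w′ ⟧     ≈⟨ +-cong (⟦⟧-* z z′) (trans (⟦⟧-* (C.- w) w′) (*-congʳ (⟦⟧-neg w))) ⟨
    ⟦ z C.* z′ ⟧ + ⟦ (C.- w) C.* w′ ⟧     ≈⟨ ⟦⟧-+ (z C.* z′) ((C.- w) C.* w′) ⟨
    ⟦ (z C.* z′) C.+ ((C.- w) C.* w′) ⟧   ∎)
    where open ≈-Reasoning R.setoid

  -- The sign of an integer a - b is found by comparing the naturals a and b; this is the source of
  -- all decidability in the spectral part.
  isInteger-compare : ∀ {r} {Result : Set r} {x} → IsInteger x →
    (x < 0# → Result) → (x ≈ 0# → Result) → (0# < x → Result) → Result
  isInteger-compare (z@(a , b) , x≈z) lt eq gt with ℕ.<-cmp a b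
  ... | tri< a<b _ _    = lt (0<-⇒< (<.<-respʳ-≈
    (trans (solve 2 (λ a b → b :- a := con (0 , 0) :- (a :- b)) refl (fromℕ a) (fromℕ b))
      (+-congˡ (-‿cong (sym (trans x≈z (⟦⟧≈difference z)))))) (<⇒0<- (fromℕ-mono-< a<b))))
  ... | tri≈ _ ≡.refl _ = eq (trans x≈z (trans (⟦⟧≈difference z) (-‿inverseʳ (fromℕ a))))
  ... | tri> _ _ b<a    = gt (<.<-respʳ-≈ (sym (trans x≈z (⟦⟧≈difference z))) (<⇒0<- (fromℕ-mono-< b<a)))

-- Quadratic forms and symmetric elimination.

module QuadraticForms {c ℓ₁ ℓ₂ ℓ₃} (ℝ : RealField c ℓ₁ ℓ₂ ℓ₃) where
  open RealField ℝ hiding (zero)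
  open OrderedField ℝ
  private
    module R = CommutativeRing commutativeRing
    module < = IsStrictPartialOrder isStrictPartialOrder
  open SemiringSum R.semiring using (sum; sum-cong-≋; *-distribˡ-sum)


  infix 8 _∙_

  _∙_ : ∀ {n} → Vector ℝ n → Vector ℝ n → Carrier
  x ∙ y = sum (λ i → x i * y i)

  ∙-cong : ∀ {n} {x x′ y y′ : Vector ℝ n} → (∀ i → x i ≈ x′ i) → (∀ i → y i ≈ y′ i) → x ∙ y ≈ x′ ∙ y′
  ∙-cong x≈x′ y≈y′ = sum-cong-≋ (λ i → *-cong (x≈x′ i) (y≈y′ i))

  ∙-comm : ∀ {n} (x y : Vector ℝ n) → x ∙ y ≈ y ∙ x
  ∙-comm x y = sum-cong-≋ (λ i → *-comm (x i) (y i))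

  ∙-zeroʳ : ∀ {n} (x : Vector ℝ n) {y} → (∀ i → y i ≈ 0#) → x ∙ y ≈ 0#
  ∙-zeroʳ {zero}  x y≈0 = refl
  ∙-zeroʳ {suc n} x y≈0 = trans
    (+-cong (trans (*-congˡ (y≈0 zero)) (R.zeroʳ _)) (∙-zeroʳ (x ∘ suc) (y≈0 ∘ suc)))
    (+-identityˡ 0#)

  ∙-linearʳ : ∀ {n} (x : Vector ℝ n) s y t z →
    x ∙ (λ i → s * y i + t * z i) ≈ s * (x ∙ y) + t * (x ∙ z)
  ∙-linearʳ {zero}  x s y t z =
    solve 2 (λ s t → con (0 , 0) := s :* con (0 , 0) :+ t :* con (0 , 0)) refl s t
  ∙-linearʳ {suc n} x s y t z = trans (+-congˡ (∙-linearʳ (x ∘ suc) s (y ∘ suc) t (z ∘ suc)))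
    (solve 7 (λ x s y t z u v →
      x :* (s :* y :+ t :* z) :+ (s :* u :+ t :* v) := s :* (x :* y :+ u) :+ t :* (x :* z :+ v))
      refl (x zero) s (y zero) t (z zero) ((x ∘ suc) ∙ (y ∘ suc)) ((x ∘ suc) ∙ (z ∘ suc)))

  ∙-linearˡ : ∀ {n} s (y : Vector ℝ n) t z x →
    (λ i → s * y i + t * z i) ∙ x ≈ s * (y ∙ x) + t * (z ∙ x)
  ∙-linearˡ s y t z x = trans (∙-comm _ x) (trans (∙-linearʳ x s y t z)
    (+-cong (*-congˡ (∙-comm x y)) (*-congˡ (∙-comm x z))))

  ∙-scaleʳ : ∀ {n} (x : Vector ℝ n) s y → x ∙ (λ i → s * y i) ≈ s * (x ∙ y)
  ∙-scaleʳ x s y = sym (trans (*-distribˡ-sum s (λ i → x i * y i))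
    (sum-cong-≋ λ i → solve 3 (λ s x y → s :* (x :* y) := x :* (s :* y)) refl s (x i) (y i)))

  norm² : ∀ {n} → Vector ℝ n → Carrier
  norm² x = x ∙ x

  0≤norm² : ∀ {n} (x : Vector ℝ n) → 0# ≤ norm² x
  0≤norm² {zero}  x = <-irrefl
  0≤norm² {suc n} x = nonneg+nonneg (0≤x*x (x zero)) (0≤norm² (x ∘ suc))

  norm²-scale : ∀ {n} s (x : Vector ℝ n) → norm² (λ i → s * x i) ≈ s * s * norm² x
  norm²-scale s x = trans (∙-scaleʳ _ s x) (trans (*-congˡ (trans (∙-comm _ x) (∙-scaleʳ x s x)))
    (sym (*-assoc s s (norm² x))))

  form : ∀ {n} → Matrix ℝ n → Vector ℝ n → Carrier
  form M x = x ∙ mulVec ℝ M x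

  form-scale : ∀ {n} (M : Matrix ℝ n) s x → form M (λ i → s * x i) ≈ s * s * form M x
  form-scale M s x = begin
    (λ i → s * x i) ∙ mulVec ℝ M (λ i → s * x i) ≈⟨ ∙-cong (λ _ → refl) (λ i → ∙-scaleʳ (M i) s x) ⟩
    (λ i → s * x i) ∙ (λ i → s * mulVec ℝ M x i) ≈⟨ ∙-scaleʳ (λ i → s * x i) s (mulVec ℝ M x) ⟩
    s * ((λ i → s * x i) ∙ mulVec ℝ M x)         ≈⟨ *-congˡ (∙-comm (λ i → s * x i) (mulVec ℝ M x)) ⟩
    s * (mulVec ℝ M x ∙ (λ i → s * x i))         ≈⟨ *-congˡ (∙-scaleʳ (mulVec ℝ M x) s x) ⟩
    s * (s * (mulVec ℝ M x ∙ x))                 ≈⟨ *-assoc s s _ ⟨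
    s * s * (mulVec ℝ M x ∙ x)                   ≈⟨ *-congˡ (∙-comm (mulVec ℝ M x) x) ⟩
    s * s * form M x                             ∎
    where open ≈-Reasoning R.setoid

  IsSymmetric : ∀ {n} → Matrix ℝ n → Set ℓ₁
  IsSymmetric M = ∀ i j → M i j ≈ M j i

  minor : ∀ {n} → Matrix ℝ (suc n) → Matrix ℝ n
  minor M i j = M (suc i) (suc j)

  border : ∀ {n} → Matrix ℝ (suc n) → Vector ℝ n
  border M j = M zero (suc j)

  form-block : ∀ {n} (M : Matrix ℝ (suc n)) → IsSymmetric M → ∀ x → let y = x ∘ suc in
    form M x ≈ M zero zero * (x zero * x zero) + (x zero + x zero) * (border M ∙ y) + form (minor M) y
  form-block M symmetric x = begin
    s * (a * s + β) + y ∙ (λ i → M (suc i) zero * s + mulVec ℝ (minor M) y i)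
      ≈⟨ +-congˡ (∙-cong (λ _ → refl) λ i → +-cong
           (trans (*-comm _ s) (*-congˡ (symmetric (suc i) zero))) (sym (*-identityˡ _))) ⟩
    s * (a * s + β) + y ∙ (λ i → s * border M i + 1# * mulVec ℝ (minor M) y i)
      ≈⟨ +-congˡ (∙-linearʳ y s (border M) 1# (mulVec ℝ (minor M) y)) ⟩
    s * (a * s + β) + (s * (y ∙ border M) + 1# * form (minor M) y)
      ≈⟨ +-congˡ (+-congʳ (*-congˡ (∙-comm y (border M)))) ⟩
    s * (a * s + β) + (s * β + 1# * form (minor M) y)
      ≈⟨ solve 4 (λ a s β q → s :* (a :* s :+ β) :+ (s :* β :+ con (1 , 0) :* q)
           := a :* (s :* s) :+ (s :+ s) :* β :+ q) refl a s β (form (minor M) y) ⟩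
    a * (s * s) + (s + s) * β + form (minor M) y ∎
    where
    open ≈-Reasoning R.setoid
    a = M zero zero
    s = x zero
    y = x ∘ suc
    β = border M ∙ y

  -- The Schur complement of the corner entry, scaled by it to avoid division.
  schur : ∀ {n} → Matrix ℝ (suc n) → Matrix ℝ n
  schur M i j = M zero zero * minor M i j + - border M i * border M j

  mulVec-schur : ∀ {n} (M : Matrix ℝ (suc n)) y i →
    mulVec ℝ (schur M) y i ≈ M zero zero * mulVec ℝ (minor M) y i + - border M i * (border M ∙ y)
  mulVec-schur M y i = ∙-linearˡ (M zero zero) (minor M i) (- border M i) (border M) y

  form-schur : ∀ {n} (M : Matrix ℝ (suc n)) y → let β = border M ∙ y in
    form (schur M) y ≈ M zero zero * form (minor M) y - β * β
  form-schur M y = begin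
    y ∙ mulVec ℝ (schur M) y
      ≈⟨ ∙-cong (λ _ → refl) (λ i → trans (mulVec-schur M y i) (+-congˡ
           (solve 2 (λ b β → :- b :* β := :- β :* b) refl (border M i) β))) ⟩
    y ∙ (λ i → a * mulVec ℝ (minor M) y i + - β * border M i)
      ≈⟨ ∙-linearʳ y a (mulVec ℝ (minor M) y) (- β) (border M) ⟩
    a * form (minor M) y + - β * (y ∙ border M)
      ≈⟨ +-congˡ (*-congˡ (∙-comm y (border M))) ⟩
    a * form (minor M) y + - β * β
      ≈⟨ solve 2 (λ q β → q :+ :- β :* β := q :- β :* β) refl (a * form (minor M) y) β ⟩
    a * form (minor M) y - β * β ∎
    where
    open ≈-Reasoning R.setoid
    a = M zero zero
    β = border M ∙ y

  -- A crude Cauchy-Schwarz inequality: (b₀ y₀ + β)² ≤ 2 (b₀ y₀)² + 2 β², with defect (b₀ y₀ - β)².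
  -- The constant doubles with each coordinate, which is harmless because only its existence
  -- matters.
  ∙-bound : ∀ {n} (b : Vector ℝ n) →
    ∃[ κ ] 0# ≤ κ × (∀ y → 0# ≤ κ * norm² y - (b ∙ y) * (b ∙ y))
  ∙-bound {zero}  b = 0# , <-irrefl , λ y → ≤-reflexive
    (solve 0 (con (0 , 0) := con (0 , 0) :* con (0 , 0) :- con (0 , 0) :* con (0 , 0)) refl)
  ∙-bound {suc n} b with ∙-bound (b ∘ suc)
  ... | κ , 0≤κ , bound = κ′ , nonneg+nonneg (0≤2* (0≤x*x b₀)) (0≤2* 0≤κ) , λ y →
    ≤-resp refl (identity b₀ (y zero) ((b ∘ suc) ∙ (y ∘ suc)) κ (norm² (y ∘ suc)))
      (nonneg+nonneg (nonneg+nonneg (nonneg+nonneg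
        (0≤2* (bound (y ∘ suc)))
        (0≤x*x (b₀ * y zero - (b ∘ suc) ∙ (y ∘ suc))))
        (0≤2* (nonneg*nonneg 0≤κ (0≤x*x (y zero)))))
        (0≤2* (nonneg*nonneg (0≤x*x b₀) (0≤norm² (y ∘ suc)))))
    where
    b₀ = b zero
    κ′ = (b₀ * b₀ + b₀ * b₀) + (κ + κ)
    0≤2* : ∀ {x} → 0# ≤ x → 0# ≤ x + x
    0≤2* 0≤x = nonneg+nonneg 0≤x 0≤x
    identity : ∀ b y β κ N →
      ((κ * N - β * β) + (κ * N - β * β)) + (b * y - β) * (b * y - β)
        + (κ * (y * y) + κ * (y * y)) + (b * b * N + b * b * N)
      ≈ ((b * b + b * b) + (κ + κ)) * (y * y + N) - (b * y + β) * (b * y + β)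
    identity = solve 5 (λ b y β κ N →
      ((κ :* N :- β :* β) :+ (κ :* N :- β :* β)) :+ (b :* y :- β) :* (b :* y :- β)
        :+ (κ :* (y :* y) :+ κ :* (y :* y)) :+ (b :* b :* N :+ b :* b :* N)
      := ((b :* b :+ b :* b) :+ (κ :+ κ)) :* (y :* y :+ N) :- (b :* y :+ β) :* (b :* y :+ β)) refl

  -- The margin δ is what the limit argument in `¬positiveDefinite` consumes; from pointwise
  -- positivity it would follow only by compactness of the unit sphere.
  PositiveDefinite : ∀ {n} → Matrix ℝ n → Set _
  PositiveDefinite M = ∃[ δ ] 0# < δ × (∀ x → 0# ≤ form M x - δ * norm² x)

  Singular : ∀ {n} → Matrix ℝ n → Set _
  Singular M = ∃[ x ] 0# < norm² x × (∀ i → mulVec ℝ M x i ≈ 0#)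

  NegativeSomewhere : ∀ {n} → Matrix ℝ n → Set _
  NegativeSomewhere M = ∃[ x ] 0# < norm² x × form M x < 0#

  basis₀ : ∀ {n} → Vector ℝ (suc n)
  basis₀ = 1# ◂ λ _ → 0#

  0<norm²-basis₀ : ∀ {n} → 0# < norm² (basis₀ {n})
  0<norm²-basis₀ {n} = pos+nonneg (*-pos 0<1 0<1) (0≤norm² {n} (λ _ → 0#))

  mulVec-basis₀ : ∀ {n} (M : Matrix ℝ (suc n)) i → mulVec ℝ M basis₀ i ≈ M i zero
  mulVec-basis₀ M i = trans (+-cong (*-identityʳ _) (∙-zeroʳ (M i ∘ suc) λ _ → refl)) (+-identityʳ _)

  form-basis₀ : ∀ {n} (M : Matrix ℝ (suc n)) → form M basis₀ ≈ M zero zero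
  form-basis₀ M = trans (∙-comm basis₀ (mulVec ℝ M basis₀))
    (trans (mulVec-basis₀ (λ _ → mulVec ℝ M basis₀) zero) (mulVec-basis₀ M zero))

  -- Completing the square gives a · form M x = z² + form (schur M) y with z = a s + β. What remains
  -- is to bound norm² x by z² and norm² y: (a s)² = (z - β)² ≤ 2 z² + 2 β², and `bound` controls
  -- β².
  positiveDefinite-schur : ∀ {n} (M : Matrix ℝ (suc n)) → IsSymmetric M →
    0# < M zero zero → PositiveDefinite (schur M) → PositiveDefinite M
  positiveDefinite-schur {n} M symmetric 0<a (δ , 0<δ , S≥δ) with ∙-bound (border M)
  ... | κ , 0≤κ , bound = η * a , *-pos 0<η 0<a , λ x →
    *-cancelˡ-nonneg 0<a (≤-resp refl (sym (scaled x)) (nonneg x))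
    where
    a = M zero zero
    -- With w = 1 / D and η = δ / D, both leftover coefficients are nonnegative: 1 - 2 η = w (2 κ +
    -- a²) for z², and δ - η (2 κ + a²) = 2 η δ for `N`.
    D = (δ + δ) + (κ + κ) + a * a
    inv : ∃[ w ] 0# < w × D * w ≈ 1#
    inv = inverse (pos+nonneg (pos+nonneg (pos+nonneg 0<δ (<⇒≤ 0<δ)) (nonneg+nonneg 0≤κ 0≤κ)) (0≤x*x a))
    w = proj₁ inv
    η = δ * w
    0<η : 0# < η
    0<η = *-pos 0<δ (proj₁ (proj₂ inv))
    0≤w = <⇒≤ (proj₁ (proj₂ inv))
    module _ (x : Vector ℝ (suc n)) where
      s = x zero
      y = x ∘ suc
      β = border M ∙ y
      N = norm² y
      Q = form (minor M) y
      z = a * s + β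
      rest : Carrier
      rest = w * ((κ + κ) + a * a) * (z * z) + (form (schur M) y - δ * N) +
        ((η * (κ * N - β * β) + η * (κ * N - β * β)) + (η * (δ * N) + η * (δ * N)) +
         η * ((z + β) * (z + β)))
      nonneg : 0# ≤ rest
      nonneg = nonneg+nonneg (nonneg+nonneg
        (nonneg*nonneg (nonneg*nonneg 0≤w (nonneg+nonneg (nonneg+nonneg 0≤κ 0≤κ) (0≤x*x a))) (0≤x*x z))
        (S≥δ y))
        (nonneg+nonneg (nonneg+nonneg (nonneg+nonneg bound′ bound′) (nonneg+nonneg ηδN ηδN))
          (nonneg*nonneg (<⇒≤ 0<η) (0≤x*x (z + β))))
        where
        bound′ = nonneg*nonneg (<⇒≤ 0<η) (bound y)
        ηδN = nonneg*nonneg (<⇒≤ 0<η) (nonneg*nonneg (<⇒≤ 0<δ) (0≤norm² y))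
      scaled : a * (form M x - η * a * norm² x) ≈ rest
      scaled = begin
        a * (form M x - η * a * (s * s + N))
          ≈⟨ *-congˡ (+-congʳ (form-block M symmetric x)) ⟩
        a * (a * (s * s) + (s + s) * β + Q - η * a * (s * s + N))
          ≈⟨ solve 6 (λ a s β Q η N →
               a :* (a :* (s :* s) :+ (s :+ s) :* β :+ Q :- η :* a :* (s :* s :+ N))
               := con (1 , 0) :* ((a :* s :+ β) :* (a :* s :+ β)) :+ (a :* Q :- β :* β)
                  :- η :* (a :* a) :* (s :* s) :- η :* (a :* a) :* N) refl a s β Q η N ⟩
        1# * (z * z) + (a * Q - β * β) - η * (a * a) * (s * s) - η * (a * a) * N
          ≈⟨ +-congʳ (+-congʳ (+-cong (*-congʳ (sym (proj₂ (proj₂ inv)))) (sym (form-schur M y)))) ⟩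
        D * w * (z * z) + S - η * (a * a) * (s * s) - η * (a * a) * N
          ≈⟨ solve 8 (λ δ κ a w s β N S →
               let D = (δ :+ δ) :+ (κ :+ κ) :+ a :* a
                   z = a :* s :+ β
                   η = δ :* w in
               D :* w :* (z :* z) :+ S :- η :* (a :* a) :* (s :* s) :- η :* (a :* a) :* N
               := w :* ((κ :+ κ) :+ a :* a) :* (z :* z) :+ (S :- D :* w :* (δ :* N)) :+
                  ((η :* (κ :* N :- β :* β) :+ η :* (κ :* N :- β :* β)) :+ (η :* (δ :* N) :+ η :* (δ :* N)) :+
                   η :* ((z :+ β) :* (z :+ β)))) refl δ κ a w s β N S ⟩
        w * ((κ + κ) + a * a) * (z * z) + (S - D * w * (δ * N)) + _
          ≈⟨ +-congʳ (+-congˡ (+-congˡ (-‿cong (trans (*-congʳ (proj₂ (proj₂ inv))) (*-identityˡ _))))) ⟩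
        rest ∎
        where
        open ≈-Reasoning R.setoid
        S = form (schur M) y

  -- The kernel vector y is lifted to (- β , a y): the first coordinate of the image is - a β + a β,
  -- and the others are those of `schur M` applied to y.
  singular-schur : ∀ {n} (M : Matrix ℝ (suc n)) → IsSymmetric M →
    0# < M zero zero → Singular (schur M) → Singular M
  singular-schur {n} M symmetric 0<a (y , 0<N , Sy≈0) = x , 0<norm²x , Mx≈0
    where
    a = M zero zero
    β = border M ∙ y
    x : Vector ℝ (suc n)
    x = (- β) ◂ λ i → a * y i
    0<norm²x : 0# < norm² x
    0<norm²x = nonneg+pos (0≤x*x (- β)) (<.<-respʳ-≈ (sym (norm²-scale a y)) (*-pos (*-pos 0<a 0<a) 0<N))
    Mx≈0 : ∀ i → mulVec ℝ M x i ≈ 0#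
    Mx≈0 zero    = trans (+-congˡ (∙-scaleʳ (border M) a y))
      (solve 2 (λ a β → a :* :- β :+ a :* β := con (0 , 0)) refl a β)
    Mx≈0 (suc i) = begin
      M (suc i) zero * - β + minor M i ∙ (λ j → a * y j)
        ≈⟨ +-cong (*-congʳ (symmetric (suc i) zero)) (∙-scaleʳ (minor M i) a y) ⟩
      border M i * - β + a * mulVec ℝ (minor M) y i
        ≈⟨ solve 3 (λ b β m → b :* :- β :+ m := m :+ :- b :* β) refl (border M i) β _ ⟩
      a * mulVec ℝ (minor M) y i + - border M i * β
        ≈⟨ mulVec-schur M y i ⟨
      mulVec ℝ (schur M) y i
        ≈⟨ Sy≈0 i ⟩
      0# ∎
      where open ≈-Reasoning R.setoid

  -- The lift (- β , a y) makes the completed square a s + β vanish, so only the Schur complement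
  -- contributes to the form.
  negative-schur : ∀ {n} (M : Matrix ℝ (suc n)) → IsSymmetric M →
    0# < M zero zero → NegativeSomewhere (schur M) → NegativeSomewhere M
  negative-schur {n} M symmetric 0<a (y , 0<N , S<0) = x , 0<norm²x ,
    <.<-respˡ-≈ (sym Q≈) (pos*neg 0<a S<0)
    where
    a = M zero zero
    β = border M ∙ y
    x : Vector ℝ (suc n)
    x = (- β) ◂ λ i → a * y i
    0<norm²x : 0# < norm² x
    0<norm²x = nonneg+pos (0≤x*x (- β)) (<.<-respʳ-≈ (sym (norm²-scale a y)) (*-pos (*-pos 0<a 0<a) 0<N))
    Q≈ : form M x ≈ a * form (schur M) y
    Q≈ = begin
      form M x
        ≈⟨ form-block M symmetric x ⟩
      a * (- β * - β) + (- β + - β) * (border M ∙ (λ i → a * y i)) + form (minor M) (λ i → a * y i)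
        ≈⟨ +-cong (+-congˡ (*-congˡ (∙-scaleʳ (border M) a y))) (form-scale (minor M) a y) ⟩
      a * (- β * - β) + (- β + - β) * (a * β) + a * a * form (minor M) y
        ≈⟨ solve 3 (λ a β q → a :* (:- β :* :- β) :+ (:- β :+ :- β) :* (a :* β) :+ a :* a :* q
             := a :* (a :* q :- β :* β)) refl a β _ ⟩
      a * (a * form (minor M) y - β * β)
        ≈⟨ *-congˡ (form-schur M y) ⟨
      a * form (schur M) y ∎
      where open ≈-Reasoning R.setoid

  -- When the corner vanishes, the form at (s , t b) is 2 s t B + t² W, which is linear in s and so
  -- can be driven below 0.
  negative-border : ∀ {n} (M : Matrix ℝ (suc n)) → IsSymmetric M →
    M zero zero ≈ 0# → 0# < norm² (border M) → NegativeSomewhere M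
  negative-border {n} M symmetric a≈0 0<B = x ,
    nonneg+pos (0≤x*x s) (<.<-respʳ-≈ (sym (norm²-scale t b)) (*-pos (*-pos 0<t 0<t) 0<B)) ,
    0<-⇒< (<.<-respʳ-≈ (sym Q≈) (*-pos 0<t 0<t))
    where
    b = border M
    B = norm² b
    W = form (minor M) b
    -- As t = 2 B, the form becomes t² (s + W), and this s makes it equal to - t².
    s = - (W + 1#)
    t = B + B
    0<t : 0# < t
    0<t = pos+nonneg 0<B (<⇒≤ 0<B)
    x : Vector ℝ (suc n)
    x = s ◂ λ i → t * b i
    Q≈ : 0# - form M x ≈ t * t
    Q≈ = begin
      0# - form M x
        ≈⟨ +-congˡ (-‿cong (form-block M symmetric x)) ⟩
      0# - (M zero zero * (s * s) + (s + s) * (b ∙ (λ i → t * b i)) + form (minor M) (λ i → t * b i))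
        ≈⟨ +-congˡ (-‿cong (+-cong (+-cong (*-congʳ a≈0) (*-congˡ (∙-scaleʳ b t b)))
             (form-scale (minor M) t b))) ⟩
      0# - (0# * (s * s) + (s + s) * (t * B) + t * t * W)
        ≈⟨ solve 2 (λ B W → let t = B :+ B ; s = :- (W :+ con (1 , 0)) in
             con (0 , 0) :- (con (0 , 0) :* (s :* s) :+ (s :+ s) :* (t :* B) :+ t :* t :* W) := t :* t)
             refl B W ⟩
      t * t ∎
      where open ≈-Reasoning R.setoid

  singular-border : ∀ {n} (M : Matrix ℝ (suc n)) → IsSymmetric M →
    M zero zero ≈ 0# → (∀ j → border M j ≈ 0#) → Singular M
  singular-border {n} M symmetric a≈0 b≈0 = basis₀ , 0<norm²-basis₀ {n} , λ where
    zero    → trans (mulVec-basis₀ M zero) a≈0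
    (suc i) → trans (mulVec-basis₀ M (suc i)) (trans (symmetric (suc i) zero) (b≈0 i))

  -- In continuation-passing style, so that one proof serves both as an algorithm
  -- on integer matrices and, with result ⊥, as a double-negated case distinction
  -- on real ones.
  module Trichotomy {r p} (Result : Set r) (P : Carrier → Set p)
    (P-closed : ∀ {a b c d} → P a → P b → P c → P d → P (a * b + - c * d))
    (compare : ∀ {x} → P x → (x < 0# → Result) → (x ≈ 0# → Result) → (0# < x → Result) → Result)
    where

    zero-or-nonzero : ∀ {n} (b : Vector ℝ n) → (∀ j → P (b j)) →
      ((∀ j → b j ≈ 0#) → Result) → (0# < norm² b → Result) → Result
    zero-or-nonzero {zero}  b Pb zero! nonzero = zero! λ ()
    zero-or-nonzero {suc n} b Pb zero! nonzero = compare (Pb zero)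
      (λ b₀<0 → nonzero (pos+nonneg (0<x*x (inj₁ b₀<0)) (0≤norm² (b ∘ suc))))
      (λ b₀≈0 → zero-or-nonzero (b ∘ suc) (Pb ∘ suc)
        (λ b≈0 → zero! λ where zero → b₀≈0 ; (suc j) → b≈0 j)
        (λ 0<B → nonzero (nonneg+pos (0≤x*x (b zero)) 0<B)))
      (λ 0<b₀ → nonzero (pos+nonneg (0<x*x (inj₂ 0<b₀)) (0≤norm² (b ∘ suc))))

    -- Elimination on the corner entry. A negative corner is a negative value at `basis₀`; a zero
    -- corner settles the matter through its border; only a positive corner calls for recursion, and
    -- each of the three outcomes for the Schur complement lifts back.
    classify : ∀ {n} (M : Matrix ℝ n) → (∀ i j → P (M i j)) → IsSymmetric M →
      (PositiveDefinite M → Result) → (Singular M → Result) → (NegativeSomewhere M → Result) → Result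
    classify {zero}  M PM symmetric pd sg ng = pd (1# , 0<1 , λ x → ≤-reflexive
      (solve 0 (con (0 , 0) := con (0 , 0) :- con (1 , 0) :* con (0 , 0)) refl))
    classify {suc n} M PM symmetric pd sg ng = compare (PM zero zero)
      (λ a<0 → ng (basis₀ , 0<norm²-basis₀ {n} , <.<-respˡ-≈ (sym (form-basis₀ M)) a<0))
      (λ a≈0 → zero-or-nonzero (border M) (λ j → PM zero (suc j))
        (sg ∘ singular-border M symmetric a≈0)
        (ng ∘ negative-border M symmetric a≈0))
      (λ 0<a → classify (schur M)
        (λ i j → P-closed (PM zero zero) (PM (suc i) (suc j)) (PM zero (suc i)) (PM zero (suc j)))
        (λ i j → +-cong (*-congˡ (symmetric (suc i) (suc j)))
          (solve 2 (λ b c → :- b :* c := :- c :* b) refl (border M i) (border M j)))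
        (pd ∘ positiveDefinite-schur M symmetric 0<a)
        (sg ∘ singular-schur M symmetric 0<a)
        (ng ∘ negative-schur M symmetric 0<a))

-- The largest eigenvalue of an integral symmetric matrix.

module Spectrum {c ℓ₁ ℓ₂ ℓ₃} (ℝ : RealField c ℓ₁ ℓ₂ ℓ₃) where
  open RealField ℝ hiding (zero)
  open OrderedField ℝ
  open QuadraticForms ℝ
  private
    module R = CommutativeRing commutativeRing
    module < = IsStrictPartialOrder isStrictPartialOrder

  identity : ∀ {n} → Matrix ℝ n
  identity zero    zero    = 1#
  identity zero    (suc j) = 0#
  identity (suc i) zero    = 0#
  identity (suc i) (suc j) = identity i j

  identity-symmetric : ∀ {n} → IsSymmetric (identity {n})
  identity-symmetric zero    zero    = refl
  identity-symmetric zero    (suc j) = refl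
  identity-symmetric (suc i) zero    = refl
  identity-symmetric (suc i) (suc j) = identity-symmetric i j

  identity-isInteger : ∀ {n} (i j : Fin n) → IsInteger (identity i j)
  identity-isInteger zero    zero    = (1 , 0) , refl
  identity-isInteger zero    (suc j) = (0 , 0) , refl
  identity-isInteger (suc i) zero    = (0 , 0) , refl
  identity-isInteger (suc i) (suc j) = identity-isInteger i j

  mulVec-identity : ∀ {n} (x : Vector ℝ n) i → mulVec ℝ identity x i ≈ x i
  mulVec-identity x zero    = trans
    (+-cong (*-identityˡ _) (trans (∙-comm (λ _ → 0#) (x ∘ suc)) (∙-zeroʳ (x ∘ suc) (λ _ → refl))))
    (+-identityʳ _)
  mulVec-identity x (suc i) = trans (+-cong (R.zeroˡ _) (mulVec-identity (x ∘ suc) i)) (+-identityˡ _)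

  -- Each row r contributes 2 y (r ∙ x) ≤ y² + (r ∙ x)². The matrix is rectangular and y is
  -- independent of x so that the induction can remove one row at a time.
  mulVec-bound : ∀ {m n} (rows : Fin m → Vector ℝ n) →
    ∃[ κ ] 0# ≤ κ × (∀ x y → 0# ≤ norm² y + κ * norm² x - (y ∙ (λ i → rows i ∙ x) + y ∙ (λ i → rows i ∙ x)))
  mulVec-bound {zero}  rows = 0# , <-irrefl , λ x y → ≤-reflexive
    (solve 1 (λ N → con (0 , 0) := con (0 , 0) :+ con (0 , 0) :* N :- (con (0 , 0) :+ con (0 , 0)))
      refl (norm² x))
  mulVec-bound {suc m} rows with ∙-bound (rows zero) | mulVec-bound (rows ∘ suc)
  ... | κ₀ , 0≤κ₀ , bound₀ | κ , 0≤κ , bound = κ₀ + κ , nonneg+nonneg 0≤κ₀ 0≤κ , λ x y →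
    ≤-resp refl
      (solve 7 (λ κ₀ κ X y β Y d →
        (κ₀ :* X :- β :* β) :+ (y :- β) :* (y :- β) :+ (Y :+ κ :* X :- (d :+ d))
        := (y :* y :+ Y) :+ (κ₀ :+ κ) :* X :- ((y :* β :+ d) :+ (y :* β :+ d)))
        refl κ₀ κ (norm² x) (y zero) (rows zero ∙ x) (norm² (y ∘ suc))
        ((y ∘ suc) ∙ (λ i → rows (suc i) ∙ x)))
      (nonneg+nonneg (nonneg+nonneg (bound₀ x) (0≤x*x (y zero - rows zero ∙ x))) (bound x (y ∘ suc)))

  abstract
    -- Take y = x in `mulVec-bound`. Adding another (1 + κ) · norm² x turns the inequality into
    -- twice the claimed one, so no constant has to be halved.
    form-bound : ∀ {n} (A : Matrix ℝ n) → ∃[ κ ] (∀ x → 0# ≤ κ * norm² x - form A x)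
    form-bound A with mulVec-bound A
    ... | κ , 0≤κ , bound = 1# + κ , λ x → *-cancelˡ-nonneg (pos+nonneg 0<1 (<⇒≤ 0<1)) (≤-resp refl
      (solve 3 (λ κ N q → (N :+ κ :* N :- (q :+ q)) :+ (con (1 , 0) :+ κ) :* N
        := (con (1 , 0) :+ con (1 , 0)) :* ((con (1 , 0) :+ κ) :* N :- q)) refl κ (norm² x) (form A x))
      (nonneg+nonneg (bound x x) (nonneg*nonneg (nonneg+nonneg (<⇒≤ 0<1) 0≤κ) (0≤norm² x))))

  abstract
    1/[1+_] : ∀ i → ∃[ v ] 0# < v × fromℕ (suc i) * v ≈ 1#
    1/[1+ i ] = inverse (0<fromℕ[1+n] i)

  1/[1+_]→0 : ∀ {ε} → 0# < ε → ∃[ N ] (∀ i → N ℕ.≤ i → proj₁ 1/[1+ i ] < ε)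
  1/[1+_]→0 {ε} 0<ε with inverse 0<ε
  ... | ε⁻¹ , 0<ε⁻¹ , ε*ε⁻¹≈1 with archimedean ε⁻¹
  ...   | N , ε⁻¹<N = N , λ i N≤i → let v , 0<v , [1+i]v≈1 = 1/[1+ i ] in
    0<-⇒< (<.<-respʳ-≈
      (begin
        ε * v * (fromℕ (suc i) - ε⁻¹)
          ≈⟨ solve 4 (λ ε v f e → ε :* v :* (f :- e) := ε :* (f :* v) :- (ε :* e) :* v) refl ε v (fromℕ (suc i)) ε⁻¹ ⟩
        ε * (fromℕ (suc i) * v) - (ε * ε⁻¹) * v
          ≈⟨ +-cong (*-congˡ [1+i]v≈1) (-‿cong (*-congʳ ε*ε⁻¹≈1)) ⟩
        ε * 1# - 1# * v
          ≈⟨ solve 2 (λ ε v → ε :* con (1 , 0) :- con (1 , 0) :* v := ε :- v) refl ε v ⟩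
        ε - v ∎)
      (*-pos (*-pos 0<ε 0<v)
        (<⇒0<- (<-trans (<-≤-trans ε⁻¹<N (fromℕ-mono-≤ N≤i)) (fromℕ-mono-< (ℕ.n<1+n i))))))
    where open ≈-Reasoning R.setoid

  shift : ∀ {n} → Carrier → Carrier → Matrix ℝ n → Matrix ℝ n
  shift t u A i j = t * identity i j + - u * A i j

  mulVec-shift : ∀ {n} t u (A : Matrix ℝ n) x i → mulVec ℝ (shift t u A) x i ≈ t * x i + - u * mulVec ℝ A x i
  mulVec-shift t u A x i = trans (∙-linearˡ t (identity i) (- u) (A i) x)
    (+-congʳ (*-congˡ (mulVec-identity x i)))

  form-shift : ∀ {n} t u (A : Matrix ℝ n) x → form (shift t u A) x ≈ t * norm² x + - u * form A x
  form-shift t u A x = trans (∙-cong (λ _ → refl) (mulVec-shift t u A x))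
    (∙-linearʳ x t x (- u) (mulVec ℝ A x))

  shift-symmetric : ∀ {n} t u {A : Matrix ℝ n} → IsSymmetric A → IsSymmetric (shift t u A)
  shift-symmetric t u symmetric i j =
    +-cong (*-congˡ (identity-symmetric i j)) (*-congˡ (symmetric i j))

  module LargestEigenvalue {n} (A : Matrix ℝ n) (symmetric : IsSymmetric A)
    (integral : ∀ i j → IsInteger (A i j))
    (nonneg : ∃[ x ] 0# < norm² x × 0# ≤ form A x) where

    -- For positive u these compare p / u with the Rayleigh quotients of `A`, cleared of
    -- denominators: p / u exceeds all of them, or fails to exceed one.
    Above Below : ℕ → ℕ → Set _
    Above p u = ∀ x → 0# < norm² x → 0# < fromℕ p * norm² x - fromℕ u * form A x
    Below p u = ∃[ x ] 0# < norm² x × 0# ≤ fromℕ u * form A x - fromℕ p * norm² x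

    abstract
      -- The matrix p I - u A has integer entries, so `classify` acts on it as an algorithm. Its
      -- singular case counts as `Below`, with equality.
      decide : ∀ p u → Above p u ⊎ Below p u
      decide p u = classify (shift P U A)
        (λ i j → isInteger-closed (fromℕ-isInteger p) (identity-isInteger i j) (fromℕ-isInteger u) (integral i j))
        (shift-symmetric P U symmetric)
        (λ (δ , 0<δ , bound) → inj₁ λ x 0<N → <.<-respʳ-≈
          (trans (solve 2 (λ d f → d :+ (f :- d) := f) refl (δ * norm² x) (form (shift P U A) x)) (expand x))
          (pos+nonneg (*-pos 0<δ 0<N) (bound x)))
        (λ (x , 0<N , Mx≈0) → inj₂ (x , 0<N , ≤-reflexive
          (trans (sym -0≈0) (trans (-‿cong (sym (∙-zeroʳ x Mx≈0))) (flip x)))))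
        (λ (x , 0<N , f<0) → inj₂ (x , 0<N , <⇒≤ (<.<-respʳ-≈ (flip x) (neg-pos f<0))))
        where
        P U : Carrier
        P = fromℕ p
        U = fromℕ u
        open Trichotomy (Above p u ⊎ Below p u) IsInteger isInteger-closed isInteger-compare
        -0≈0 : - 0# ≈ 0#
        -0≈0 = solve 0 (:- con (0 , 0) := con (0 , 0)) refl
        expand : ∀ x → form (shift P U A) x ≈ P * norm² x - U * form A x
        expand x = trans (form-shift P U A x)
          (solve 4 (λ P N U q → P :* N :+ :- U :* q := P :* N :- U :* q) refl P (norm² x) U (form A x))
        flip : ∀ x → - form (shift P U A) x ≈ U * form A x - P * norm² x
        flip x = trans (-‿cong (expand x))
          (solve 2 (λ a b → :- (a :- b) := b :- a) refl (P * norm² x) (U * form A x))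

    above-large : ∀ p u κ → (∀ x → 0# ≤ κ * norm² x - form A x) → fromℕ u * κ < fromℕ p → Above p u
    above-large p u κ bound uκ<p x 0<N = <.<-respʳ-≈
      (solve 5 (λ p u κ N q → (p :- u :* κ) :* N :+ u :* (κ :* N :- q) := p :* N :- u :* q)
        refl (fromℕ p) (fromℕ u) κ (norm² x) (form A x))
      (pos+nonneg (*-pos (<⇒0<- uκ<p) 0<N) (nonneg*nonneg (0≤fromℕ u) (bound x)))

    ¬above-0 : ∀ u → ¬ Above 0 u
    ¬above-0 u above = let x , 0<N , 0≤q = nonneg in
      nonneg*nonneg (0≤fromℕ u) 0≤q (0<-⇒< (<.<-respʳ-≈
        (solve 2 (λ N q → con (0 , 0) :* N :- q := con (0 , 0) :- q) refl (norm² x) (fromℕ u * form A x))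
        (above x 0<N)))

    -- The descent by units cannot pass 0, because `nonneg` supplies a Rayleigh quotient that is at
    -- least 0. This is why natural numerators are enough.
    search : ∀ u p → Above p u → ∃[ p ] Below p u × Above (suc p) u
    search u zero    above = contradiction above (¬above-0 u)
    search u (suc p) above with decide p u
    ... | inj₁ above′ = search u p above′
    ... | inj₂ below  = p , below , above

    abstract
      threshold : ∀ u → ∃[ p ] Below p u × Above (suc p) u
      threshold u =
        let κ , bound = form-bound A ; p , uκ<p = archimedean (fromℕ u * κ) in
        search u p (above-large p u κ bound uκ<p)

    below-scaled : ∀ p u {v} → 0# < v → fromℕ u * v ≈ 1# → Below p u →
      ∃[ x ] 0# < norm² x × 0# ≤ form A x - fromℕ p * v * norm² x
    below-scaled p u {v} 0<v uv≈1 (x , 0<N , 0≤) = x , 0<N , ≤-resp refl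
      (trans (solve 5 (λ u q p N v → v :* (u :* q :- p :* N) := (u :* v) :* q :- p :* v :* N)
               refl (fromℕ u) (form A x) (fromℕ p) (norm² x) v)
             (+-congʳ (trans (*-congʳ uv≈1) (*-identityˡ _))))
      (nonneg*nonneg (<⇒≤ 0<v) 0≤)

    above-scaled : ∀ p u {v} → 0# < v → fromℕ u * v ≈ 1# → Above (suc p) u →
      ∀ x → 0# < norm² x → 0# < (fromℕ p * v + v) * norm² x - form A x
    above-scaled p u {v} 0<v uv≈1 above x 0<N = <.<-respʳ-≈
      (trans (solve 5 (λ u q p N v →
               v :* ((con (1 , 0) :+ p) :* N :- u :* q) := (p :* v :+ v) :* N :- (u :* v) :* q)
               refl (fromℕ u) (form A x) (fromℕ p) (norm² x) v)
             (+-congˡ (-‿cong (trans (*-congʳ uv≈1) (*-identityˡ _)))))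
      (*-pos 0<v (above x 0<N))

    abstract
      -- With u = i + 1, `approx i` and `approx i + gap i` are p / u and (p + 1) / u, which enclose
      -- the supremum of the Rayleigh quotients.
      approx gap : ℕ → Carrier
      gap i    = proj₁ 1/[1+ i ]
      approx i = fromℕ (proj₁ (threshold (suc i))) * gap i

      approx-below : ∀ i → ∃[ x ] 0# < norm² x × 0# ≤ form A x - approx i * norm² x
      approx-below i = below-scaled (proj₁ (threshold (suc i))) (suc i) (proj₁ (proj₂ 1/[1+ i ]))
        (proj₂ (proj₂ 1/[1+ i ])) (proj₁ (proj₂ (threshold (suc i))))

      approx-above : ∀ i x → 0# < norm² x → 0# < (approx i + gap i) * norm² x - form A x
      approx-above i = above-scaled (proj₁ (threshold (suc i))) (suc i) (proj₁ (proj₂ 1/[1+ i ]))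
        (proj₂ (proj₂ 1/[1+ i ])) (proj₂ (proj₂ (threshold (suc i))))

      gap→0 : ∀ {ε} → 0# < ε → ∃[ N ] (∀ i → N ℕ.≤ i → gap i < ε)
      gap→0 = 1/[1+_]→0

    -- The witness of `approx-below i` has a Rayleigh quotient that is at least `approx i` and, by
    -- `approx-above j`, less than `approx j + gap j`.
    approx-cauchy : ∀ i j → approx i < approx j + gap j
    approx-cauchy i j = let x , 0<N , 0≤ = approx-below i in
      0<-⇒< (pos-cancelʳ 0<N (<.<-respʳ-≈
        (solve 4 (λ a b q N → (b :* N :- q) :+ (q :- a :* N) := (b :- a) :* N)
          refl (approx i) (approx j + gap j) (form A x) (norm² x))
        (pos+nonneg (approx-above j x 0<N) 0≤)))

    abstract
      limit : ∃[ l ] (∀ ε → 0# < ε → ∃[ N ] (∀ i → N ℕ.≤ i → (approx i < l + ε) × (l < approx i + ε)))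
      limit = complete approx λ ε 0<ε → let N , small = gap→0 0<ε in
        -- Only j has to be large, since `approx-cauchy` holds for every i.
        N , λ i j _ N≤j → <-trans (approx-cauchy i j) (+-monoʳ-< (approx j) (small j N≤j))

    λ₁ : Carrier
    λ₁ = proj₁ limit

    form≤λ₁*norm² : ∀ x → 0# < norm² x → form A x ≤ λ₁ * norm² x
    form≤λ₁*norm² x 0<N η<0 = <-irrefl (<.<-respʳ-≈ sum≈0
      (pos+nonneg (approx-above i x 0<N) (<⇒≤ (*-pos 0<slack 0<N))))
      where
      N = norm² x
      q = form A x
      η = q - λ₁ * N
      2N⁻¹ = inverse (pos+nonneg 0<N (<⇒≤ 0<N))
      w = proj₁ 2N⁻¹
      -- Half of the excess per unit of norm²: one ε absorbs the distance from `approx i` to the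
      -- limit and another absorbs `gap i`, so together they use up exactly η.
      ε = η * w
      0<ε : 0# < ε
      0<ε = *-pos (<⇒0<- η<0) (proj₁ (proj₂ 2N⁻¹))
      near = proj₂ limit ε 0<ε
      small = gap→0 0<ε
      i = proj₁ near ℕ.⊔ proj₁ small
      0<slack : 0# < (λ₁ + ε - approx i) + (ε - gap i)
      0<slack = pos+nonneg (<⇒0<- (proj₁ (proj₂ near i (ℕ.m≤m⊔n _ _))))
        (<⇒≤ (<⇒0<- (proj₂ small i (ℕ.m≤n⊔m (proj₁ near) _))))
      sum≈0 : ((approx i + gap i) * N - q) + ((λ₁ + ε - approx i) + (ε - gap i)) * N ≈ 0#
      sum≈0 = begin
        ((approx i + gap i) * N - q) + ((λ₁ + ε - approx i) + (ε - gap i)) * N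
          ≈⟨ solve 6 (λ a g N q l w → let η = q :- l :* N in
               ((a :+ g) :* N :- q) :+ ((l :+ η :* w :- a) :+ (η :* w :- g)) :* N
               := η :* ((N :+ N) :* w) :- η) refl (approx i) (gap i) N q λ₁ w ⟩
        η * ((N + N) * w) - η ≈⟨ +-congʳ (trans (*-congˡ (proj₂ (proj₂ 2N⁻¹))) (*-identityʳ η)) ⟩
        η - η                 ≈⟨ -‿inverseʳ η ⟩
        0#                    ∎
        where open ≈-Reasoning R.setoid

    -- A margin δ would put every Rayleigh quotient at or below λ₁ - δ, whereas some `approx i`
    -- exceeds λ₁ - δ and is attained or surpassed by a Rayleigh quotient.
    ¬positiveDefinite : ¬ PositiveDefinite (shift λ₁ 1# A)
    ¬positiveDefinite (δ , 0<δ , bound) = <-irrefl (<.<-respʳ-≈ sum≈0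
      (pos+nonneg (*-pos (<⇒0<- (proj₂ (near i ℕ.≤-refl))) 0<N) (nonneg+nonneg 0≤ (bound x))))
      where
      near = proj₂ (proj₂ limit δ 0<δ)
      i = proj₁ (proj₂ limit δ 0<δ)
      x = proj₁ (approx-below i)
      0<N = proj₁ (proj₂ (approx-below i))
      0≤ = proj₂ (proj₂ (approx-below i))
      sum≈0 : (approx i + δ - λ₁) * norm² x +
        ((form A x - approx i * norm² x) + (form (shift λ₁ 1# A) x - δ * norm² x)) ≈ 0#
      sum≈0 = trans (+-congˡ (+-congˡ (+-congʳ (form-shift λ₁ 1# A x))))
        (solve 5 (λ a δ l N q → (a :+ δ :- l) :* N :+ ((q :- a :* N) :+ ((l :* N :+ :- con (1 , 0) :* q) :- δ :* N))
          := con (0 , 0)) refl (approx i) δ λ₁ (norm² x) (form A x))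

    -- Of the three outcomes of `classify` for λ₁ I - A, definiteness and a negative value are
    -- already refuted, which leaves a kernel vector. The entries are arbitrary reals here, so pivot
    -- signs come from `¬¬-trichotomy` and the result type is ⊥.
    ¬¬eigenvector : ¬ ¬ (∃[ x ] 0# < norm² x × (∀ i → mulVec ℝ A x i ≈ λ₁ * x i))
    ¬¬eigenvector none = classify (shift λ₁ 1# A) (λ _ _ → _) (shift-symmetric λ₁ 1# symmetric)
      ¬positiveDefinite
      (λ (x , 0<N , Mx≈0) → none (x , 0<N , λ i → begin
        mulVec ℝ A x i
          ≈⟨ solve 2 (λ a b → a := b :- (b :+ :- con (1 , 0) :* a)) refl (mulVec ℝ A x i) (λ₁ * x i) ⟩
        λ₁ * x i - (λ₁ * x i + - 1# * mulVec ℝ A x i)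
          ≈⟨ +-congˡ (-‿cong (trans (sym (mulVec-shift λ₁ 1# A x i)) (Mx≈0 i))) ⟩
        λ₁ * x i - 0#
          ≈⟨ solve 1 (λ a → a :- con (0 , 0) := a) refl (λ₁ * x i) ⟩
        λ₁ * x i ∎))
      (λ (x , 0<N , f<0) → form≤λ₁*norm² x 0<N (0<-⇒< (<.<-respʳ-≈
        (trans (-‿cong (form-shift λ₁ 1# A x))
          (solve 2 (λ a q → :- (a :+ :- con (1 , 0) :* q) := q :- a) refl (λ₁ * norm² x) (form A x)))
        (neg-pos f<0))))
      where
      open ≈-Reasoning R.setoid
      open Trichotomy ⊥ (λ _ → ⊤ {0ℓ}) (λ _ _ _ _ → _) (λ {x} _ → ¬¬-trichotomy x)

-- Sums over subsets and over the elements of a subset.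

module IndependentSets where
  open import Data.Nat.Base
  open import Data.Nat.Properties
  open import Relation.Binary.PropositionalEquality
  open ℕSum using (sum)

  private variable
    n : ℕ

  χ : ∀ {a} {A : Set a} → Dec A → ℕ
  χ a? = if does a? then 1 else 0

  χ≤1 : ∀ {a} {A : Set a} (a? : Dec A) → χ a? ≤ 1
  χ≤1 (yes _) = ≤-refl
  χ≤1 (no _)  = z≤n

  χ-yes : ∀ {a} {A : Set a} (a? : Dec A) → A → χ a? ≡ 1
  χ-yes (yes _) a = refl
  χ-yes (no ¬a) a = contradiction a ¬a

  χ-no : ∀ {a} {A : Set a} (a? : Dec A) → ¬ A → χ a? ≡ 0
  χ-no (yes a) ¬a = contradiction a ¬a
  χ-no (no _)  ¬a = refl

  χ-cong : ∀ {a b} {A : Set a} {B : Set b} (a? : Dec A) (b? : Dec B) →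
    (A → B) → (B → A) → χ a? ≡ χ b?
  χ-cong (yes a) b? a⇒b b⇒a = sym (χ-yes b? (a⇒b a))
  χ-cong (no ¬a) b? a⇒b b⇒a = sym (χ-no b? (¬a ∘ b⇒a))

  χ-*-mono : ∀ {a} {A : Set a} (a? : Dec A) {x y} → (A → x ≤ y) → χ a? * x ≤ χ a? * y
  χ-*-mono (yes a) p = +-monoˡ-≤ 0 (p a)
  χ-*-mono (no _)  p = z≤n

  -- The recursion follows that of `subsets`, so double counting can proceed by induction on the
  -- vertex set instead of on lists.
  sumₛ : (Subset n → ℕ) → ℕ
  sumₛ {zero}  f = f []
  sumₛ {suc n} f = sumₛ (f ∘ (outside ∷_)) + sumₛ (f ∘ (inside ∷_))

  sumₛ-mono : {f g : Subset n → ℕ} → (∀ S → f S ≤ g S) → sumₛ f ≤ sumₛ g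
  sumₛ-mono {zero}  f≤g = f≤g []
  sumₛ-mono {suc n} f≤g = +-mono-≤ (sumₛ-mono (f≤g ∘ (outside ∷_))) (sumₛ-mono (f≤g ∘ (inside ∷_)))

  sumₛ-cong : {f g : Subset n → ℕ} → (∀ S → f S ≡ g S) → sumₛ f ≡ sumₛ g
  sumₛ-cong f≡g =
    ≤-antisym (sumₛ-mono (≤-reflexive ∘ f≡g)) (sumₛ-mono (≤-reflexive ∘ sym ∘ f≡g))

  +-interchange : ∀ a b c d → (a + b) + (c + d) ≡ (a + c) + (b + d)
  +-interchange = solve-∀

  sumₛ-+ : (f g : Subset n → ℕ) → sumₛ (λ S → f S + g S) ≡ sumₛ f + sumₛ g
  sumₛ-+ {zero}  f g = refl
  sumₛ-+ {suc n} f g = trans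
    (cong₂ _+_ (sumₛ-+ (f ∘ (outside ∷_)) (g ∘ (outside ∷_)))
               (sumₛ-+ (f ∘ (inside ∷_)) (g ∘ (inside ∷_))))
    (+-interchange (sumₛ (f ∘ (outside ∷_))) _ _ _)

  sumₛ-* : ∀ c (f : Subset n → ℕ) → sumₛ (λ S → c * f S) ≡ c * sumₛ f
  sumₛ-* {zero}  c f = refl
  sumₛ-* {suc n} c f = trans
    (cong₂ _+_ (sumₛ-* c (f ∘ (outside ∷_))) (sumₛ-* c (f ∘ (inside ∷_))))
    (sym (*-distribˡ-+ c (sumₛ (f ∘ (outside ∷_))) _))

  length-filter-map : ∀ {a b p} {A : Set a} {B : Set b} {P : B → Set p} (P? : ∀ y → Dec (P y))
    (f : A → B) (xs : List A) →
    length (filter P? (map f xs)) ≡ length (filter (P? ∘ f) xs)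
  length-filter-map P? f []       = refl
  length-filter-map P? f (x ∷ xs) with does (P? (f x))
  ... | true  = cong suc (length-filter-map P? f xs)
  ... | false = length-filter-map P? f xs

  length-filter-subsets : ∀ {p} {P : Subset n → Set p} (P? : ∀ S → Dec (P S)) →
    length (filter P? (subsets n)) ≡ sumₛ (χ ∘ P?)
  length-filter-subsets {zero}  P? with does (P? [])
  ... | true  = refl
  ... | false = refl
  length-filter-subsets {suc n} P? = begin
    length (filter P? (subsets (suc n)))
      ≡⟨ cong length (filter-++ P? (map (outside ∷_) (subsets n)) _) ⟩
    length (filter P? (map (outside ∷_) (subsets n)) List.++ filter P? (map (inside ∷_) (subsets n)))
      ≡⟨ length-++ (filter P? (map (outside ∷_) (subsets n))) ⟩
    length (filter P? (map (outside ∷_) (subsets n))) + length (filter P? (map (inside ∷_) (subsets n)))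
      ≡⟨ cong₂ _+_ (half outside) (half inside) ⟩
    sumₛ (χ ∘ P?) ∎
    where
    open ≡-Reasoning
    half : ∀ b → length (filter P? (map (b ∷_) (subsets n))) ≡ sumₛ (χ ∘ P? ∘ (b ∷_))
    half b = trans (length-filter-map P? (b ∷_) (subsets n)) (length-filter-subsets (P? ∘ (b ∷_)))

  sumIn : Subset n → (Fin n → ℕ) → ℕ
  sumIn []            f = 0
  sumIn (outside ∷ S) f = sumIn S (f ∘ suc)
  sumIn (inside ∷ S)  f = f zero + sumIn S (f ∘ suc)

  sumIn-mono : (S : Subset n) {f g : Fin n → ℕ} →
    (∀ {v} → v ∈ S → f v ≤ g v) → sumIn S f ≤ sumIn S g
  sumIn-mono []            f≤g = z≤n
  sumIn-mono (outside ∷ S) f≤g = sumIn-mono S (f≤g ∘ there)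
  sumIn-mono (inside ∷ S)  f≤g = +-mono-≤ (f≤g here) (sumIn-mono S (f≤g ∘ there))

  sumIn-cong : (S : Subset n) {f g : Fin n → ℕ} →
    (∀ {v} → v ∈ S → f v ≡ g v) → sumIn S f ≡ sumIn S g
  sumIn-cong S f≡g = ≤-antisym
    (sumIn-mono S (λ v∈S → ≤-reflexive (f≡g v∈S)))
    (sumIn-mono S (λ v∈S → ≤-reflexive (sym (f≡g v∈S))))

  sumIn-+ : (S : Subset n) (f g : Fin n → ℕ) → sumIn S (λ v → f v + g v) ≡ sumIn S f + sumIn S g
  sumIn-+ []            f g = refl
  sumIn-+ (outside ∷ S) f g = sumIn-+ S (f ∘ suc) (g ∘ suc)
  sumIn-+ (inside ∷ S)  f g = trans (cong (f zero + g zero +_) (sumIn-+ S (f ∘ suc) (g ∘ suc)))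
    (+-interchange (f zero) _ _ _)

  sumIn-* : (S : Subset n) (c : ℕ) (f : Fin n → ℕ) → sumIn S (λ v → c * f v) ≡ c * sumIn S f
  sumIn-* []            c f = sym (*-zeroʳ c)
  sumIn-* (outside ∷ S) c f = sumIn-* S c (f ∘ suc)
  sumIn-* (inside ∷ S)  c f = trans (cong (c * f zero +_) (sumIn-* S c (f ∘ suc)))
    (sym (*-distribˡ-+ c (f zero) _))

  sumIn-const : (S : Subset n) (c : ℕ) → sumIn S (λ _ → c) ≡ ∣ S ∣ * c
  sumIn-const []            c = refl
  sumIn-const (outside ∷ S) c = sumIn-const S c
  sumIn-const (inside ∷ S)  c = cong (c +_) (sumIn-const S c)

  sumIn-swap : ∀ {m} (S : Subset m) (T : Subset n) (f : Fin m → Fin n → ℕ) →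
    sumIn S (λ v → sumIn T (f v)) ≡ sumIn T (λ w → sumIn S (λ v → f v w))
  sumIn-swap []            T f = sym (trans (sumIn-const T 0) (*-zeroʳ ∣ T ∣))
  sumIn-swap (outside ∷ S) T f = sumIn-swap S T (f ∘ suc)
  sumIn-swap (inside ∷ S)  T f = trans (cong (sumIn T (f zero) +_) (sumIn-swap S T (f ∘ suc)))
    (sym (sumIn-+ T (f zero) _))

  sumIn≤sum : (S : Subset n) (f : Fin n → ℕ) → sumIn S f ≤ sum f
  sumIn≤sum []            f = z≤n
  sumIn≤sum (outside ∷ S) f = ≤-trans (sumIn≤sum S (f ∘ suc)) (m≤n+m _ (f zero))
  sumIn≤sum (inside ∷ S)  f = +-monoʳ-≤ (f zero) (sumIn≤sum S (f ∘ suc))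

  ∣S∣+∣∁S∣≡n : (S : Subset n) → ∣ S ∣ + ∣ ∁ S ∣ ≡ n
  ∣S∣+∣∁S∣≡n []            = refl
  ∣S∣+∣∁S∣≡n (inside ∷ S)  = cong suc (∣S∣+∣∁S∣≡n S)
  ∣S∣+∣∁S∣≡n (outside ∷ S) = trans (+-suc ∣ S ∣ ∣ ∁ S ∣) (cong suc (∣S∣+∣∁S∣≡n S))

  ∣S∣≡0⇒∉ : ∀ {S : Subset n} {x} → ∣ S ∣ ≡ 0 → x ∉ S
  ∣S∣≡0⇒∉ {S = outside ∷ S} p (there x∈S) = ∣S∣≡0⇒∉ p x∈S

  sumₛ-empty : sumₛ {n} (λ S → χ (∣ S ∣ ≟ 0)) ≡ 1
  sumₛ-empty {zero}  = refl
  sumₛ-empty {suc n} = cong₂ _+_ (sumₛ-empty {n}) (sumₛ-* {n} 0 (λ _ → 0))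

  infixl 6 _⊕_ _⊖_

  _⊕_ _⊖_ : Subset n → Fin n → Subset n
  S ⊕ v = S [ v ]≔ inside
  S ⊖ v = S [ v ]≔ outside

  ⊖-⊕ : ∀ {S : Subset n} {v} → v ∈ S → S ⊖ v ⊕ v ≡ S
  ⊖-⊕ here        = refl
  ⊖-⊕ (there v∈S) = cong (_ ∷_) (⊖-⊕ v∈S)

  ∣⊕∣ : ∀ {S : Subset n} {v} → v ∈ ∁ S → ∣ S ⊕ v ∣ ≡ suc ∣ S ∣
  ∣⊕∣ {S = outside ∷ S} here      = refl
  ∣⊕∣ {S = outside ∷ S} (there p) = ∣⊕∣ p
  ∣⊕∣ {S = inside ∷ S}  (there p) = cong suc (∣⊕∣ p)

  ∈-⊕ : ∀ {S : Subset n} {v x} → x ∈ S ⊕ v → x ≡ v ⊎ x ∈ S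
  ∈-⊕ {S = _ ∷ S} {v = zero}  here      = inj₁ refl
  ∈-⊕ {S = _ ∷ S} {v = zero}  (there p) = inj₂ (there p)
  ∈-⊕ {S = _ ∷ S} {v = suc v} here      = inj₂ here
  ∈-⊕ {S = _ ∷ S} {v = suc v} (there p) with ∈-⊕ {S = S} p
  ... | inj₁ refl = inj₁ refl
  ... | inj₂ x∈S  = inj₂ (there x∈S)

  ⊆-⊕ : ∀ {S : Subset n} {v x} → x ∈ S → x ∈ S ⊕ v
  ⊆-⊕ {v = zero}  here      = here
  ⊆-⊕ {v = zero}  (there p) = there p
  ⊆-⊕ {v = suc v} here      = here
  ⊆-⊕ {v = suc v} (there p) = there (⊆-⊕ p)

  sumIn-∁⊖ : ∀ {S : Subset n} {v} → v ∈ S → (f : Fin n → ℕ) →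
    sumIn (∁ (S ⊖ v)) f ≡ f v + sumIn (∁ S) f
  sumIn-∁⊖ here                         f = refl
  sumIn-∁⊖ {S = inside ∷ S}  (there p) f = sumIn-∁⊖ p (f ∘ suc)
  sumIn-∁⊖ {S = outside ∷ S} (there p) f = trans (cong (f zero +_) (sumIn-∁⊖ p (f ∘ suc)))
    (x+[y+z] (f zero) (f (suc _)) (sumIn (∁ S) (f ∘ suc)))
    where
    x+[y+z] : ∀ x y z → x + (y + z) ≡ y + (x + z)
    x+[y+z] = solve-∀

  -- Pairs (S , v) with v ∈ S correspond to pairs (T , v) with v ∉ T via T = S ⊖ v.
  sumₛ-exchange : (F : Subset n → Fin n → ℕ) →
    sumₛ (λ S → sumIn S (λ v → F (S ⊖ v) v)) ≡ sumₛ (λ T → sumIn (∁ T) (F T))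
  sumₛ-exchange {zero}  F = refl
  sumₛ-exchange {suc n} F = begin
    sumₛ (λ S → sumIn S (λ v → F (outside ∷ (S ⊖ v)) (suc v)))
      + sumₛ (λ S → F (outside ∷ S) zero + sumIn S (λ v → F (inside ∷ (S ⊖ v)) (suc v)))
      ≡⟨ cong₂ _+_ (sumₛ-exchange (λ S v → F (outside ∷ S) (suc v)))
           (trans (sumₛ-+ (λ S → F (outside ∷ S) zero) _)
                  (cong (sumₛ (λ S → F (outside ∷ S) zero) +_)
                    (sumₛ-exchange (λ S v → F (inside ∷ S) (suc v))))) ⟩
    sumₛ (λ T → sumIn (∁ T) (λ v → F (outside ∷ T) (suc v)))
      + (sumₛ (λ T → F (outside ∷ T) zero) + sumₛ (λ T → sumIn (∁ T) (λ v → F (inside ∷ T) (suc v))))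
      ≡⟨ rearrange (sumₛ (λ T → sumIn (∁ T) (λ v → F (outside ∷ T) (suc v))))
                     (sumₛ (λ T → F (outside ∷ T) zero)) _ ⟩
    (sumₛ (λ T → F (outside ∷ T) zero) + sumₛ (λ T → sumIn (∁ T) (λ v → F (outside ∷ T) (suc v))))
      + sumₛ (λ T → sumIn (∁ T) (λ v → F (inside ∷ T) (suc v)))
      ≡⟨ cong (_+ sumₛ (λ T → sumIn (∁ T) (λ v → F (inside ∷ T) (suc v))))
           (sym (sumₛ-+ (λ T → F (outside ∷ T) zero) _)) ⟩
    sumₛ (λ T → sumIn (∁ T) (F T)) ∎
    where
    open ≡-Reasoning
    rearrange : ∀ x y z → x + (y + z) ≡ (y + x) + z
    rearrange = solve-∀

  prodIn : Subset n → (Fin n → ℕ) → ℕ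
  prodIn []            f = 1
  prodIn (outside ∷ S) f = prodIn S (f ∘ suc)
  prodIn (inside ∷ S)  f = f zero * prodIn S (f ∘ suc)

  0⊎1 : ∀ {m} → m ≤ 1 → m ≡ 0 ⊎ m ≡ 1
  0⊎1 z≤n       = inj₁ refl
  0⊎1 (s≤s z≤n) = inj₂ refl

  -- A union bound: if some factor vanishes then the summand at the same vertex is positive, and
  -- otherwise the product is.
  1≤prodIn+sumIn : (S : Subset n) {f g : Fin n → ℕ} → (∀ v → 1 ≤ f v + g v) →
    1 ≤ prodIn S f + sumIn S g
  1≤prodIn+sumIn []                   p = ≤-refl
  1≤prodIn+sumIn (outside ∷ S)        p = 1≤prodIn+sumIn S (p ∘ suc)
  1≤prodIn+sumIn (inside ∷ S) {f} {g} p with f zero | p zero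
  ... | zero  | 1≤g₀ = ≤-trans 1≤g₀ (m≤m+n (g zero) _)
  ... | suc m | _    = ≤-trans (1≤prodIn+sumIn S {f ∘ suc} {g ∘ suc} (p ∘ suc))
    (+-mono-≤ (m≤m+n (prodIn S (f ∘ suc)) (m * prodIn S (f ∘ suc)))
              (m≤n+m (sumIn S (g ∘ suc)) (g zero)))

  prodIn≤1 : (S : Subset n) {f : Fin n → ℕ} → (∀ v → f v ≤ 1) → prodIn S f ≤ 1
  prodIn≤1 []            f≤1 = ≤-refl
  prodIn≤1 (outside ∷ S) f≤1 = prodIn≤1 S (f≤1 ∘ suc)
  prodIn≤1 (inside ∷ S)  f≤1 = *-mono-≤ (f≤1 zero) (prodIn≤1 S (f≤1 ∘ suc))

  prodIn≡1⇒ : (S : Subset n) {f : Fin n → ℕ} → prodIn S f ≡ 1 → ∀ {v} → v ∈ S → f v ≡ 1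
  prodIn≡1⇒ (outside ∷ S)     p (there v∈S) = prodIn≡1⇒ S p v∈S
  prodIn≡1⇒ (inside ∷ S) {f}  p here        = m*n≡1⇒m≡1 (f zero) _ p
  prodIn≡1⇒ (inside ∷ S) {f}  p (there v∈S) = prodIn≡1⇒ S (m*n≡1⇒n≡1 (f zero) _ p) v∈S

  ⇒prodIn≡1 : (S : Subset n) {f : Fin n → ℕ} → (∀ {v} → v ∈ S → f v ≡ 1) → prodIn S f ≡ 1
  ⇒prodIn≡1 []            p = refl
  ⇒prodIn≡1 (outside ∷ S) p = ⇒prodIn≡1 S (p ∘ there)
  ⇒prodIn≡1 (inside ∷ S)  p = cong₂ _*_ (p here) (⇒prodIn≡1 S (p ∘ there))

  -- At most one factor of a vanishing product can be removed to make it nonzero.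
  sumIn-prodIn-⊖ : (S : Subset n) {f : Fin n → ℕ} → (∀ v → f v ≤ 1) →
    sumIn S (λ v → prodIn (S ⊖ v) f) + prodIn S f ≤ 1 + ∣ S ∣ * prodIn S f
  sumIn-prodIn-⊖ []                f≤1 = ≤-refl
  sumIn-prodIn-⊖ (outside ∷ S)     f≤1 = sumIn-prodIn-⊖ S (f≤1 ∘ suc)
  sumIn-prodIn-⊖ (inside ∷ S) {f}  f≤1 with f zero | 0⊎1 (f≤1 zero)
  ... | _ | inj₁ refl = begin
    P + sumIn S (λ _ → 0) + 0 ≡⟨ +-identityʳ _ ⟩
    P + sumIn S (λ _ → 0)     ≡⟨ cong (P +_) (trans (sumIn-const S 0) (*-zeroʳ ∣ S ∣)) ⟩
    P + 0                     ≤⟨ +-monoˡ-≤ 0 (prodIn≤1 S (f≤1 ∘ suc)) ⟩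
    1                         ≤⟨ m≤m+n 1 _ ⟩
    1 + suc ∣ S ∣ * 0         ∎
    where
    open ≤-Reasoning
    P = prodIn S (f ∘ suc)
  ... | _ | inj₂ refl = begin
    P + sumIn S (λ v → 1 * prodIn (S ⊖ v) (f ∘ suc)) + 1 * P
      ≡⟨ cong₂ (λ x y → P + x + y) (trans (sumIn-* S 1 _) (*-identityˡ D)) (*-identityˡ P) ⟩
    P + D + P             ≡⟨ +-assoc P D P ⟩
    P + (D + P)           ≤⟨ +-monoʳ-≤ P (sumIn-prodIn-⊖ S (f≤1 ∘ suc)) ⟩
    P + (1 + ∣ S ∣ * P)   ≡⟨ rearrange P (∣ S ∣) ⟩
    1 + (P + ∣ S ∣ * P)   ≡⟨ cong (λ p → 1 + suc ∣ S ∣ * p) (sym (*-identityˡ P)) ⟩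
    1 + suc ∣ S ∣ * (1 * P) ∎
    where
    open ≤-Reasoning
    P = prodIn S (f ∘ suc)
    D = sumIn S (λ v → prodIn (S ⊖ v) (f ∘ suc))
    rearrange : ∀ p s → p + (1 + s * p) ≡ 1 + (p + s * p)
    rearrange = solve-∀

  -- Cauchy-Schwarz over the naturals, and the ratio recursion.

  4xy≤[x+y]² : ∀ x y → 4 * (x * y) ≤ (x + y) * (x + y)
  4xy≤[x+y]² x y with ≤-total x y
  ... | inj₁ x≤y = subst (λ z → 4 * (x * z) ≤ (x + z) * (x + z)) (m+[n∸m]≡n x≤y) (lemma x (y ∸ x))
    where
    expand : ∀ x t → (x + (x + t)) * (x + (x + t)) ≡ 4 * (x * (x + t)) + t * t
    expand = solve-∀
    lemma : ∀ x t → 4 * (x * (x + t)) ≤ (x + (x + t)) * (x + (x + t))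
    lemma x t = subst (4 * (x * (x + t)) ≤_) (sym (expand x t)) (m≤m+n _ (t * t))
  ... | inj₂ y≤x = subst (λ z → 4 * (z * y) ≤ (z + y) * (z + y)) (m+[n∸m]≡n y≤x) (lemma y (x ∸ y))
    where
    expand : ∀ y t → ((y + t) + y) * ((y + t) + y) ≡ 4 * ((y + t) * y) + t * t
    expand = solve-∀
    lemma : ∀ y t → 4 * ((y + t) * y) ≤ ((y + t) + y) * ((y + t) + y)
    lemma y t = subst (4 * ((y + t) * y) ≤_) (sym (expand y t)) (m≤m+n _ (t * t))

  *-cancel-square-≤ : ∀ {x y} → x * x ≤ y * y → x ≤ y
  *-cancel-square-≤ {x} {y} x²≤y² with x ≤? y
  ... | yes x≤y = x≤y
  ... | no x≰y  = contradiction (*-mono-< (≰⇒> x≰y) (≰⇒> x≰y)) (≤⇒≯ x²≤y²)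

  -- The gluing step for Cauchy-Schwarz. The cross term satisfies (2 b b′)² ≤ 4 (a c′) (a′ c) ≤ (a
  -- c′ + a′ c)², and comparing squares avoids square roots.
  [b+b′]²≤[a+a′][c+c′] : ∀ a b c a′ b′ c′ → b * b ≤ a * c → b′ * b′ ≤ a′ * c′ →
    (b + b′) * (b + b′) ≤ (a + a′) * (c + c′)
  [b+b′]²≤[a+a′][c+c′] a b c a′ b′ c′ p p′ = begin
    (b + b′) * (b + b′)               ≡⟨ expand₁ b b′ ⟩
    b * b + b′ * b′ + 2 * (b * b′)    ≤⟨ +-mono-≤ (+-mono-≤ p p′) cross ⟩
    a * c + a′ * c′ + (a * c′ + a′ * c) ≡⟨ expand₂ a c a′ c′ ⟩
    (a + a′) * (c + c′)               ∎
    where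
    open ≤-Reasoning
    expand₁ : ∀ b b′ → (b + b′) * (b + b′) ≡ b * b + b′ * b′ + 2 * (b * b′)
    expand₁ = solve-∀
    expand₂ : ∀ a c a′ c′ → a * c + a′ * c′ + (a * c′ + a′ * c) ≡ (a + a′) * (c + c′)
    expand₂ = solve-∀
    expand₃ : ∀ b b′ → 2 * (b * b′) * (2 * (b * b′)) ≡ 4 * (b * b * (b′ * b′))
    expand₃ = solve-∀
    expand₄ : ∀ a c a′ c′ → 4 * (a * c * (a′ * c′)) ≡ 4 * (a * c′ * (a′ * c))
    expand₄ = solve-∀
    cross : 2 * (b * b′) ≤ a * c′ + a′ * c
    cross = *-cancel-square-≤ (begin
      2 * (b * b′) * (2 * (b * b′))       ≡⟨ expand₃ b b′ ⟩
      4 * (b * b * (b′ * b′))             ≤⟨ *-monoʳ-≤ 4 (*-mono-≤ p p′) ⟩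
      4 * (a * c * (a′ * c′))             ≡⟨ expand₄ a c a′ c′ ⟩
      4 * (a * c′ * (a′ * c))             ≤⟨ 4xy≤[x+y]² (a * c′) (a′ * c) ⟩
      (a * c′ + a′ * c) * (a * c′ + a′ * c) ∎)

  cauchy-schwarz : (w d : Subset n → ℕ) →
    sumₛ (λ S → w S * d S) * sumₛ (λ S → w S * d S) ≤ sumₛ w * sumₛ (λ S → w S * d S * d S)
  cauchy-schwarz {zero}  w d = ≤-reflexive (expand (w []) (d []))
    where
    expand : ∀ w d → w * d * (w * d) ≡ w * (w * d * d)
    expand = solve-∀
  cauchy-schwarz {suc n} w d = [b+b′]²≤[a+a′][c+c′]
    (sumₛ (w ∘ (outside ∷_))) (sumₛ (λ S → w (outside ∷ S) * d (outside ∷ S))) _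
    (sumₛ (w ∘ (inside ∷_)))  (sumₛ (λ S → w (inside ∷ S) * d (inside ∷ S)))  _
    (cauchy-schwarz (w ∘ (outside ∷_)) (d ∘ (outside ∷_)))
    (cauchy-schwarz (w ∘ (inside ∷_)) (d ∘ (inside ∷_)))

  -- Here a, b, c stand for k(s), k(s + 1) and (s + 2) k(s + 2). Multiply the bound for s by (s + 1)
  -- b, estimate the resulting square by Moon-Moser, and cancel s a.
  ratio-step : ∀ α n t a b c → let s = suc t in
    (suc s * b) * (suc s * b) ≤ a * (n * b + s * c) →
    α * n * a ≤ α * (suc s * b) + s * (α + n) * a →
    α * n * b ≤ α * c + suc s * (α + n) * b
  -- When a = 0, Moon-Moser forces b = 0; a positive b is ruled out by the type of `mm`.
  ratio-step α n t zero    zero    c mm ih = ≤-trans (≤-reflexive (*-zeroʳ (α * n))) z≤n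
  ratio-step α n t a@(suc _) b c mm ih = *-cancelˡ-≤ (s * a) (+-cancelˡ-≤ (α * n * (a * b)) _ _ (begin
    α * n * (a * b) + s * a * (α * n * b)
      ≡⟨ expand₁ α n a b s ⟩
    suc s * b * (α * n * a)
      ≤⟨ *-monoʳ-≤ (suc s * b) ih ⟩
    suc s * b * (α * (suc s * b) + s * (α + n) * a)
      ≡⟨ expand₂ α n a b s ⟩
    α * (suc s * b * (suc s * b)) + s * suc s * (α + n) * (a * b)
      ≤⟨ +-monoˡ-≤ _ (*-monoʳ-≤ α mm) ⟩
    α * (a * (n * b + s * c)) + s * suc s * (α + n) * (a * b)
      ≡⟨ expand₃ α n a b c s ⟩
    α * n * (a * b) + s * a * (α * c + suc s * (α + n) * b) ∎))
    where
    open ≤-Reasoning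
    s = suc t
    expand₁ : ∀ α n a b s → α * n * (a * b) + s * a * (α * n * b) ≡ suc s * b * (α * n * a)
    expand₁ = solve-∀
    expand₂ : ∀ α n a b s → suc s * b * (α * (suc s * b) + s * (α + n) * a)
      ≡ α * (suc s * b * (suc s * b)) + s * suc s * (α + n) * (a * b)
    expand₂ = solve-∀
    expand₃ : ∀ α n a b c s → α * (a * (n * b + s * c)) + s * suc s * (α + n) * (a * b)
      ≡ α * n * (a * b) + s * a * (α * c + suc s * (α + n) * b)
    expand₃ = solve-∀

  -- The Moon-Moser inequalities for independent sets.

  module _ (G : SimpleGraph n) where
    open SimpleGraph G

    degreeSum : ℕ
    degreeSum = sum (λ v → sum (λ w → χ (v ∼? w)))

    independentOfSize? : ∀ s (S : Subset n) → Dec (Independent G S × ∣ S ∣ ≡ s)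
    independentOfSize? s S = independent? G S ×-dec (∣ S ∣ ≟ s)

    wt : ℕ → Subset n → ℕ
    wt s S = χ (independentOfSize? s S)

    private
      k : ℕ → ℕ
      k = independentSetCount G

    nonadj : Fin n → Fin n → ℕ
    nonadj w v = χ (¬? (v ∼? w))

    -- The indicator that w has no neighbour in S. As a product over S it responds to the removal of
    -- a vertex by losing one factor, which `sumIn-prodIn-⊖` exploits.
    free : Subset n → Fin n → ℕ
    free S w = prodIn S (nonadj w)

    -- For an independent S, the number of its independent extensions by one vertex.
    freeCount : Subset n → ℕ
    freeCount S = sumIn (∁ S) (free S)

    k≡ : ∀ s → k s ≡ sumₛ (wt s)
    k≡ s = length-filter-subsets (independentOfSize? s)

    nonadj≤1 : ∀ w v → nonadj w v ≤ 1
    nonadj≤1 w v = χ≤1 (¬? (v ∼? w))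

    free≤1 : ∀ S w → free S w ≤ 1
    free≤1 S w = prodIn≤1 S (nonadj≤1 w)

    nonadj≡1⇒ : ∀ {w v} → nonadj w v ≡ 1 → ¬ (v ∼ w)
    nonadj≡1⇒ {w} {v} p with v ∼? w
    ... | no v≁w = v≁w

    ⇒nonadj≡1 : ∀ {w v} → ¬ (v ∼ w) → nonadj w v ≡ 1
    ⇒nonadj≡1 {w} {v} = χ-yes (¬? (v ∼? w))

    wt-size : ∀ s S {x y} → (∣ S ∣ ≡ s → x ≤ y) → wt s S * x ≤ wt s S * y
    wt-size s S p = χ-*-mono (independentOfSize? s S) (p ∘ proj₂)

    independent-⊕ : ∀ {S v} → Independent G S → free S v ≡ 1 → Independent G (S ⊕ v)
    independent-⊕ {S} {v} i f x x∈ y y∈ x∼y with ∈-⊕ x∈ | ∈-⊕ y∈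
    ... | inj₁ refl | inj₁ refl = ∼-irrefl refl x∼y
    ... | inj₁ refl | inj₂ y∈S  = nonadj≡1⇒ (prodIn≡1⇒ S f y∈S) (∼-sym x∼y)
    ... | inj₂ x∈S  | inj₁ refl = nonadj≡1⇒ (prodIn≡1⇒ S f x∈S) x∼y
    ... | inj₂ x∈S  | inj₂ y∈S  = i x x∈S y y∈S x∼y

    -- Both sides indicate that `S ⊕ v` is independent of size s + 1: independence passes to
    -- subsets, and v can be added exactly when it is free.
    wt-⊕ : ∀ s {S v} → v ∈ ∁ S → wt s S * free S v ≡ wt (suc s) (S ⊕ v)
    wt-⊕ s {S} {v} v∉S = case (independentOfSize? s S)
      where
      w⊕? = independentOfSize? (suc s) (S ⊕ v)
      case : Dec (Independent G S × ∣ S ∣ ≡ s) → wt s S * free S v ≡ wt (suc s) (S ⊕ v)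
      case (no ¬p) = trans (cong (_* free S v) (χ-no (independentOfSize? s S) ¬p))
        (sym (χ-no w⊕? λ (i , size) → ¬p
          ( (λ x x∈S y y∈S → i x (⊆-⊕ x∈S) y (⊆-⊕ y∈S))
          , suc-injective (trans (sym (∣⊕∣ v∉S)) size))))
      case (yes (i , size)) with 0⊎1 (free≤1 S v)
      ... | inj₂ f = trans (cong₂ _*_ (χ-yes (independentOfSize? s S) (i , size)) f)
        (sym (χ-yes w⊕? (independent-⊕ i f , trans (∣⊕∣ v∉S) (cong suc size))))
      ... | inj₁ f = trans (trans (cong (wt s S *_) f) (*-zeroʳ (wt s S)))
        (sym (χ-no w⊕? λ (i⊕ , _) → 0≢1+n (trans (sym f) (⇒prodIn≡1 S λ {x} x∈S →
          ⇒nonadj≡1 (i⊕ x (⊆-⊕ x∈S) v ([]≔-updates S v))))))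

    -- Double counting of the pairs formed by an independent (s + 1)-set and one of its vertices,
    -- weighted by an arbitrary f of the smaller set and the vertex.
    wt-exchange : ∀ s (f : Subset n → Fin n → ℕ) →
      sumₛ (λ T → wt s T * sumIn (∁ T) (λ v → free T v * f T v))
        ≡ sumₛ (λ S → wt (suc s) S * sumIn S (λ v → f (S ⊖ v) v))
    wt-exchange s f = begin
      sumₛ (λ T → wt s T * sumIn (∁ T) (λ v → free T v * f T v))
        ≡⟨ sumₛ-cong (λ T → trans (sym (sumIn-* (∁ T) (wt s T) _)) (sumIn-cong (∁ T) λ v∉T →
             trans (sym (*-assoc (wt s T) _ _)) (cong (_* f T _) (wt-⊕ s v∉T)))) ⟩
      sumₛ (λ T → sumIn (∁ T) (λ v → wt (suc s) (T ⊕ v) * f T v))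
        ≡⟨ sumₛ-exchange (λ T v → wt (suc s) (T ⊕ v) * f T v) ⟨
      sumₛ (λ S → sumIn S (λ v → wt (suc s) (S ⊖ v ⊕ v) * f (S ⊖ v) v))
        ≡⟨ sumₛ-cong (λ S → trans
             (sumIn-cong S λ {v} v∈S → cong (λ T → wt (suc s) T * f (S ⊖ v) v) (⊖-⊕ v∈S))
             (sumIn-* S (wt (suc s) S) _)) ⟩
      sumₛ (λ S → wt (suc s) S * sumIn S (λ v → f (S ⊖ v) v)) ∎
      where open ≡-Reasoning

    sum-freeCount : ∀ s → sumₛ (λ S → wt s S * freeCount S) ≡ suc s * k (suc s)
    sum-freeCount s = begin
      sumₛ (λ S → wt s S * freeCount S)
        ≡⟨ sumₛ-cong (λ S → cong (wt s S *_) (sumIn-cong (∁ S) λ _ → sym (*-identityʳ _))) ⟩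
      sumₛ (λ S → wt s S * sumIn (∁ S) (λ v → free S v * 1))
        ≡⟨ wt-exchange s (λ _ _ → 1) ⟩
      sumₛ (λ S → wt (suc s) S * sumIn S (λ _ → 1))
        ≡⟨ sumₛ-cong (λ S → ≤-antisym (wt-size (suc s) S (≤-reflexive ∘ size S))
                                      (wt-size (suc s) S (≤-reflexive ∘ sym ∘ size S))) ⟩
      sumₛ (λ S → wt (suc s) S * suc s)
        ≡⟨ sumₛ-cong (λ S → *-comm (wt (suc s) S) (suc s)) ⟩
      sumₛ (λ S → suc s * wt (suc s) S)
        ≡⟨ sumₛ-* (suc s) (wt (suc s)) ⟩
      suc s * sumₛ (wt (suc s))
        ≡⟨ cong (suc s *_) (k≡ (suc s)) ⟨
      suc s * k (suc s) ∎
      where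
      open ≡-Reasoning
      size : ∀ S → ∣ S ∣ ≡ suc s → sumIn S (λ _ → 1) ≡ suc s
      size S p = trans (sumIn-const S 1) (trans (*-identityʳ ∣ S ∣) p)

    -- A vertex w outside S that is free for S is free for all s + 1 sets `S ⊖ v`; any other w
    -- outside S is free for at most one of them. Either way it contributes at most 1 + s · free S
    -- w. Each removed vertex adds at most 1 for itself, and the ones total n.
    sum-freeCount-⊖ : ∀ s S → ∣ S ∣ ≡ suc s →
      sumIn S (λ v → freeCount (S ⊖ v)) ≤ n + s * freeCount S
    sum-freeCount-⊖ s S ∣S∣≡1+s = begin
      sumIn S (λ v → freeCount (S ⊖ v))
        ≡⟨ sumIn-cong S (λ v∈S → sumIn-∁⊖ v∈S _) ⟩
      sumIn S (λ v → free (S ⊖ v) v + sumIn (∁ S) (free (S ⊖ v)))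
        ≡⟨ sumIn-+ S _ _ ⟩
      sumIn S (λ v → free (S ⊖ v) v) + sumIn S (λ v → sumIn (∁ S) (free (S ⊖ v)))
        ≡⟨ cong (sumIn S (λ v → free (S ⊖ v) v) +_) (sumIn-swap S (∁ S) (λ v → free (S ⊖ v))) ⟩
      sumIn S (λ v → free (S ⊖ v) v) + sumIn (∁ S) (λ w → sumIn S (λ v → free (S ⊖ v) w))
        ≤⟨ +-mono-≤ (sumIn-mono S λ _ → free≤1 (S ⊖ _) _) (sumIn-mono (∁ S) λ {w} _ → removals w) ⟩
      sumIn S (λ _ → 1) + sumIn (∁ S) (λ w → 1 + s * free S w)
        ≡⟨ cong₂ _+_ (sumIn-const S 1) (trans (sumIn-+ (∁ S) _ _)
             (cong₂ _+_ (sumIn-const (∁ S) 1) (sumIn-* (∁ S) s (free S)))) ⟩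
      ∣ S ∣ * 1 + (∣ ∁ S ∣ * 1 + s * freeCount S)
        ≡⟨ rearrange (∣ S ∣) (∣ ∁ S ∣) (s * freeCount S) ⟩
      ∣ S ∣ + ∣ ∁ S ∣ + s * freeCount S
        ≡⟨ cong (_+ s * freeCount S) (∣S∣+∣∁S∣≡n S) ⟩
      n + s * freeCount S ∎
      where
      open ≤-Reasoning
      rearrange : ∀ x y z → x * 1 + (y * 1 + z) ≡ x + y + z
      rearrange = solve-∀
      split : ∀ s p → 1 + suc s * p ≡ 1 + s * p + p
      split = solve-∀
      removals : ∀ w → sumIn S (λ v → free (S ⊖ v) w) ≤ 1 + s * free S w
      removals w = +-cancelʳ-≤ (free S w) _ _ (begin
        sumIn S (λ v → free (S ⊖ v) w) + free S w ≤⟨ sumIn-prodIn-⊖ S (nonadj≤1 w) ⟩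
        1 + ∣ S ∣ * free S w                      ≡⟨ cong (λ m → 1 + m * free S w) ∣S∣≡1+s ⟩
        1 + suc s * free S w                      ≡⟨ split s (free S w) ⟩
        1 + s * free S w + free S w               ∎)

    -- Cauchy-Schwarz is applied to `freeCount` over the independent s-sets, whose first moment is
    -- `sum-freeCount`. In the second moment one factor is read as a choice of v, so the sum moves
    -- to the (s + 1)-sets, where `sum-freeCount-⊖` bounds it.
    moon-moser : ∀ s → (suc s * k (suc s)) * (suc s * k (suc s)) ≤
      k s * (n * k (suc s) + s * (suc (suc s) * k (suc (suc s))))
    moon-moser s = begin
      (suc s * k (suc s)) * (suc s * k (suc s))
        ≡⟨ cong (λ x → x * x) (sum-freeCount s) ⟨
      sumₛ (λ S → wt s S * freeCount S) * sumₛ (λ S → wt s S * freeCount S)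
        ≤⟨ cauchy-schwarz (wt s) freeCount ⟩
      sumₛ (wt s) * sumₛ (λ S → wt s S * freeCount S * freeCount S)
        ≤⟨ *-mono-≤ (≤-reflexive (sym (k≡ s))) second ⟩
      k s * (n * k (suc s) + s * (suc (suc s) * k (suc (suc s)))) ∎
      where
      open ≤-Reasoning
      w = wt (suc s)
      distr : ∀ x y z → x * y * z ≡ x * (z * y)
      distr = solve-∀
      distr′ : ∀ a n s x → a * (n + s * x) ≡ n * a + s * (a * x)
      distr′ = solve-∀
      second : sumₛ (λ S → wt s S * freeCount S * freeCount S)
                 ≤ n * k (suc s) + s * (suc (suc s) * k (suc (suc s)))
      second = begin
        sumₛ (λ S → wt s S * freeCount S * freeCount S)
          ≡⟨ sumₛ-cong (λ S → trans (distr (wt s S) (freeCount S) (freeCount S))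
               (cong (wt s S *_) (trans (sym (sumIn-* (∁ S) (freeCount S) (free S)))
                 (sumIn-cong (∁ S) λ _ → *-comm (freeCount S) _)))) ⟩
        sumₛ (λ S → wt s S * sumIn (∁ S) (λ v → free S v * freeCount S))
          ≡⟨ wt-exchange s (λ S _ → freeCount S) ⟩
        sumₛ (λ S → w S * sumIn S (λ v → freeCount (S ⊖ v)))
          ≤⟨ sumₛ-mono (λ S → wt-size (suc s) S (sum-freeCount-⊖ s S)) ⟩
        sumₛ (λ S → w S * (n + s * freeCount S))
          ≡⟨ sumₛ-cong (λ S → distr′ (w S) n s (freeCount S)) ⟩
        sumₛ (λ S → n * w S + s * (w S * freeCount S))
          ≡⟨ sumₛ-+ (λ S → n * w S) _ ⟩
        sumₛ (λ S → n * w S) + sumₛ (λ S → s * (w S * freeCount S))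
          ≡⟨ cong₂ _+_ (sumₛ-* n w) (sumₛ-* s (λ S → w S * freeCount S)) ⟩
        n * sumₛ w + s * sumₛ (λ S → w S * freeCount S)
          ≡⟨ cong₂ (λ x y → n * x + s * y) (sym (k≡ (suc s))) (sum-freeCount (suc s)) ⟩
        n * k (suc s) + s * (suc (suc s) * k (suc (suc s))) ∎

    k[0]≡1 : k 0 ≡ 1
    k[0]≡1 = trans (k≡ 0) (trans (sumₛ-cong emptyOnly) (sumₛ-empty {n}))
      where
      emptyOnly : ∀ S → wt 0 S ≡ χ (∣ S ∣ ≟ 0)
      emptyOnly S = χ-cong (independentOfSize? 0 S) (∣ S ∣ ≟ 0) proj₂
        (λ p → (λ x x∈S → contradiction x∈S (∣S∣≡0⇒∉ p)) , p)

    sum-wt-const : ∀ s c → sumₛ (λ S → wt s S * c) ≡ k s * c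
    sum-wt-const s c = begin
      sumₛ (λ S → wt s S * c) ≡⟨ sumₛ-cong (λ S → *-comm (wt s S) c) ⟩
      sumₛ (λ S → c * wt s S) ≡⟨ sumₛ-* c (wt s) ⟩
      c * sumₛ (wt s)         ≡⟨ cong (c *_) (k≡ s) ⟨
      c * k s                 ≡⟨ *-comm c (k s) ⟩
      k s * c                 ∎
      where open ≡-Reasoning

    k[1]≡n : k 1 ≡ n
    k[1]≡n = begin
      k 1                               ≡⟨ *-identityˡ (k 1) ⟨
      1 * k 1                           ≡⟨ sum-freeCount 0 ⟨
      sumₛ (λ S → wt 0 S * freeCount S) ≡⟨ sumₛ-cong (λ S → ≤-antisym
                                             (wt-size 0 S (≤-reflexive ∘ freeCount≡n S))
                                             (wt-size 0 S (≤-reflexive ∘ sym ∘ freeCount≡n S))) ⟩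
      sumₛ (λ S → wt 0 S * n)           ≡⟨ sum-wt-const 0 n ⟩
      k 0 * n                           ≡⟨ cong (_* n) k[0]≡1 ⟩
      1 * n                             ≡⟨ *-identityˡ n ⟩
      n                                 ∎
      where
      open ≡-Reasoning
      freeCount≡n : ∀ S → ∣ S ∣ ≡ 0 → freeCount S ≡ n
      freeCount≡n S p = begin
        freeCount S             ≡⟨ sumIn-cong (∁ S) (λ _ → ⇒prodIn≡1 S λ x∈S → contradiction x∈S (∣S∣≡0⇒∉ p)) ⟩
        sumIn (∁ S) (λ _ → 1)   ≡⟨ trans (sumIn-const (∁ S) 1) (*-identityʳ _) ⟩
        ∣ ∁ S ∣                 ≡⟨ cong (_+ ∣ ∁ S ∣) p ⟨
        ∣ S ∣ + ∣ ∁ S ∣         ≡⟨ ∣S∣+∣∁S∣≡n S ⟩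
        n                       ∎

    degree : Fin n → ℕ
    degree v = sum (λ w → χ (v ∼? w))

    -- A vertex outside S is free or is adjacent to an element of S. Taking any S spares extracting
    -- the vertex of a singleton.
    n≤freeCount+degrees : ∀ S → n ≤ freeCount S + sumIn S degree + ∣ S ∣
    n≤freeCount+degrees S = begin
      n                                                       ≡⟨ ∣S∣+∣∁S∣≡n S ⟨
      ∣ S ∣ + ∣ ∁ S ∣                                         ≡⟨ +-comm ∣ S ∣ _ ⟩
      ∣ ∁ S ∣ + ∣ S ∣                                         ≤⟨ +-monoˡ-≤ ∣ S ∣ outer ⟩
      freeCount S + sumIn S degree + ∣ S ∣                    ∎
      where
      open ≤-Reasoning
      covered : ∀ w x → 1 ≤ nonadj w x + χ (x ∼? w)
      covered w x with x ∼? w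
      ... | yes _ = ≤-refl
      ... | no _  = ≤-refl
      outer : ∣ ∁ S ∣ ≤ freeCount S + sumIn S degree
      outer = begin
        ∣ ∁ S ∣               ≡⟨ trans (sumIn-const (∁ S) 1) (*-identityʳ _) ⟨
        sumIn (∁ S) (λ _ → 1) ≤⟨ sumIn-mono (∁ S) (λ {w} _ → 1≤prodIn+sumIn S (covered w)) ⟩
        sumIn (∁ S) (λ w → free S w + sumIn S (λ x → χ (x ∼? w)))
          ≡⟨ sumIn-+ (∁ S) (free S) _ ⟩
        freeCount S + sumIn (∁ S) (λ w → sumIn S (λ x → χ (x ∼? w)))
          ≡⟨ cong (freeCount S +_) (sumIn-swap (∁ S) S (λ w x → χ (x ∼? w))) ⟩
        freeCount S + sumIn S (λ x → sumIn (∁ S) (λ w → χ (x ∼? w)))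
          ≤⟨ +-monoʳ-≤ (freeCount S) (sumIn-mono S λ {x} _ → sumIn≤sum (∁ S) (λ w → χ (x ∼? w))) ⟩
        freeCount S + sumIn S degree ∎

    -- Sum `n≤freeCount+degrees` over the n singletons. The degree terms are turned into a sum over
    -- vertices by `wt-exchange` at the empty set.
    n²≤2k[2]+degreeSum+n : n * n ≤ 2 * k 2 + degreeSum + n
    n²≤2k[2]+degreeSum+n = begin
      n * n
        ≡⟨ cong (_* n) k[1]≡n ⟨
      k 1 * n
        ≡⟨ sum-wt-const 1 n ⟨
      sumₛ (λ S → wt 1 S * n)
        ≤⟨ sumₛ-mono (λ S → wt-size 1 S λ p →
             subst (λ m → n ≤ freeCount S + sumIn S degree + m) p (n≤freeCount+degrees S)) ⟩
      sumₛ (λ S → wt 1 S * (freeCount S + sumIn S degree + 1))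
        ≡⟨ sumₛ-cong (λ S → distr (wt 1 S) (freeCount S) (sumIn S degree)) ⟩
      sumₛ (λ S → wt 1 S * freeCount S + wt 1 S * sumIn S degree + wt 1 S)
        ≡⟨ trans (sumₛ-+ _ (wt 1)) (cong (_+ sumₛ (wt 1)) (sumₛ-+ (λ S → wt 1 S * freeCount S) _)) ⟩
      sumₛ (λ S → wt 1 S * freeCount S) + sumₛ (λ S → wt 1 S * sumIn S degree) + sumₛ (wt 1)
        ≡⟨ cong₂ (λ x y → x + sumₛ (λ S → wt 1 S * sumIn S degree) + y) (sum-freeCount 1) (trans (sym (k≡ 1)) k[1]≡n) ⟩
      2 * k 2 + sumₛ (λ S → wt 1 S * sumIn S degree) + n
        ≤⟨ +-monoˡ-≤ n (+-monoʳ-≤ (2 * k 2) degrees) ⟩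
      2 * k 2 + degreeSum + n ∎
      where
      open ≤-Reasoning
      distr : ∀ w f d → w * (f + d + 1) ≡ w * f + w * d + w
      distr = solve-∀
      degrees : sumₛ (λ S → wt 1 S * sumIn S degree) ≤ degreeSum
      degrees = begin
        sumₛ (λ S → wt 1 S * sumIn S degree)
          ≡⟨ wt-exchange 0 (λ _ → degree) ⟨
        sumₛ (λ T → wt 0 T * sumIn (∁ T) (λ v → free T v * degree v))
          ≤⟨ sumₛ-mono (λ T → *-monoʳ-≤ (wt 0 T) (≤-trans
               (sumIn-mono (∁ T) λ {v} _ → ≤-trans (*-monoˡ-≤ (degree v) (free≤1 T v))
                                                     (≤-reflexive (*-identityˡ _)))
               (sumIn≤sum (∁ T) degree))) ⟩
        sumₛ (λ T → wt 0 T * degreeSum)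
          ≡⟨ sum-wt-const 0 degreeSum ⟩
        k 0 * degreeSum
          ≡⟨ trans (cong (_* degreeSum) k[0]≡1) (*-identityˡ _) ⟩
        degreeSum ∎

    -- In terms of q s = (s + 1) k (s + 1) / k s, Moon–Moser says that (n − q s) / s
    -- is nonincreasing in s; this is the resulting bound n − q s ≤ s (1 + n / α).
    ratio-bound : ∀ α → α * degreeSum ≤ n * n → ∀ s →
      α * n * k (suc s) ≤ α * (suc (suc s) * k (suc (suc s))) + suc s * (α + n) * k (suc s)
    ratio-bound α sparse zero = begin
      α * n * k 1                                 ≡⟨ cong (α * n *_) k[1]≡n ⟩
      α * n * n                                   ≡⟨ *-assoc α n n ⟩
      α * (n * n)                                 ≤⟨ *-monoʳ-≤ α n²≤2k[2]+degreeSum+n ⟩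
      α * (2 * k 2 + degreeSum + n)               ≡⟨ expand α (2 * k 2) degreeSum n ⟩
      α * (2 * k 2) + (α * degreeSum + α * n)     ≤⟨ +-monoʳ-≤ (α * (2 * k 2)) (+-monoˡ-≤ (α * n) sparse) ⟩
      α * (2 * k 2) + (n * n + α * n)             ≡⟨ cong (α * (2 * k 2) +_) (collect α n) ⟩
      α * (2 * k 2) + 1 * (α + n) * n             ≡⟨ cong (λ m → α * (2 * k 2) + 1 * (α + n) * m) k[1]≡n ⟨
      α * (2 * k 2) + 1 * (α + n) * k 1           ∎
      where
      open ≤-Reasoning
      expand : ∀ α b d n → α * (b + d + n) ≡ α * b + (α * d + α * n)
      expand = solve-∀
      collect : ∀ α n → n * n + α * n ≡ 1 * (α + n) * n
      collect = solve-∀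
    ratio-bound α sparse (suc t) =
      ratio-step α n t (k (suc t)) (k (suc (suc t))) (suc (suc (suc t)) * k (suc (suc (suc t))))
        (moon-moser (suc t)) (ratio-bound α sparse t)

    -- Multiplying the ratio bounds.

    module _ (r : ℕ) .{{_ : NonZero r}} (large : suc r * r ≤ n)
             (sparse : suc r * degreeSum ≤ n * n) where
      private
        α : ℕ
        α = suc r

      -- `large` says 1 ≤ n / (α r), hence 1 + n / α ≤ n / r, and `ratio-bound` becomes (s + 1) k(s
      -- + 1) / k(s) ≥ n - s n / r = n t / r.
      growth : ∀ s t → s + t ≡ r → n * t * k s ≤ r * (suc s * k (suc s))
      growth zero t refl = ≤-reflexive (begin
        n * r * k 0       ≡⟨ cong (n * r *_) k[0]≡1 ⟩
        n * r * 1         ≡⟨ swap n r ⟩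
        r * (1 * n)       ≡⟨ cong (λ m → r * (1 * m)) k[1]≡n ⟨
        r * (1 * k 1)     ∎)
        where
        open ≡-Reasoning
        swap : ∀ n r → n * r * 1 ≡ r * (1 * n)
        swap = solve-∀
      growth s@(suc s′) t s+t≡r = *-cancelˡ-≤ α (+-cancelˡ-≤ (s * α * n * a) _ _ (begin
        s * α * n * a + α * (n * t * a)             ≡⟨ expand₁ α n a s t ⟩
        (s + t) * (α * n * a)                       ≡⟨ cong (_* (α * n * a)) s+t≡r ⟩
        r * (α * n * a)                             ≤⟨ *-monoʳ-≤ r (ratio-bound α sparse s′) ⟩
        r * (α * c + s * (α + n) * a)               ≡⟨ expand₂ r n a s c ⟩
        s * a * (α * r + r * n) + α * (r * c)       ≤⟨ +-monoˡ-≤ _ (*-monoʳ-≤ (s * a) (+-monoˡ-≤ (r * n) large)) ⟩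
        s * a * (n + r * n) + α * (r * c)           ≡⟨ expand₃ r n a s c ⟩
        s * α * n * a + α * (r * c)                 ∎))
        where
        open ≤-Reasoning
        a = k s
        c = suc s * k (suc s)
        expand₁ : ∀ α n a s t → s * α * n * a + α * (n * t * a) ≡ (s + t) * (α * n * a)
        expand₁ = solve-∀
        expand₂ : ∀ r n a s c → r * (suc r * c + s * (suc r + n) * a)
          ≡ s * a * (suc r * r + r * n) + suc r * (r * c)
        expand₂ = solve-∀
        expand₃ : ∀ r n a s c → s * a * (n + r * n) + suc r * (r * c)
          ≡ s * suc r * n * a + suc r * (r * c)
        expand₃ = solve-∀

      -- In division-free form this is k(s) ≥ C(r, s) (n / r)^s, the number of s-cliques in a
      -- balanced complete r-partite graph when r divides n.
      product-bound : ∀ s t → s + t ≡ r → n ^ s * r ! ≤ k s * s ! * t ! * r ^ s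
      product-bound zero t refl = ≤-reflexive (begin
        1 * r !               ≡⟨ rearrange (r !) ⟩
        1 * 1 * r ! * 1       ≡⟨ cong (λ m → m * 1 * r ! * 1) k[0]≡1 ⟨
        k 0 * 1 * r ! * 1     ∎)
        where
        open ≡-Reasoning
        rearrange : ∀ m → 1 * m ≡ 1 * 1 * m * 1
        rearrange = solve-∀
      product-bound (suc s) t s+t≡r = begin
        n * n ^ s * r !                             ≡⟨ *-assoc n _ _ ⟩
        n * (n ^ s * r !)                           ≤⟨ *-monoʳ-≤ n (product-bound s (suc t) s+1+t≡r) ⟩
        n * (k s * s ! * (suc t * t !) * r ^ s)     ≡⟨ rearrange₁ n (k s) (s !) (suc t) (t !) (r ^ s) ⟩
        n * suc t * k s * (s ! * t ! * r ^ s)       ≤⟨ *-monoˡ-≤ _ (growth s (suc t) s+1+t≡r) ⟩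
        r * (suc s * k (suc s)) * (s ! * t ! * r ^ s)
          ≡⟨ rearrange₂ r (suc s) (k (suc s)) (s !) (t !) (r ^ s) ⟩
        k (suc s) * (suc s * s !) * t ! * (r * r ^ s) ∎
        where
        open ≤-Reasoning
        s+1+t≡r = trans (+-suc s t) s+t≡r
        rearrange₁ : ∀ n a x t y z → n * (a * x * (t * y) * z) ≡ n * t * a * (x * y * z)
        rearrange₁ = solve-∀
        rearrange₂ : ∀ r s b x y z → r * (s * b) * (x * y * z) ≡ b * (s * x) * y * (r * z)
        rearrange₂ = solve-∀

      n^r≤k[r]r^r : n ^ r ≤ k r * r ^ r
      n^r≤k[r]r^r = *-cancelʳ-≤ _ _ (r !) {{r !≢0}} (begin
        n ^ r * r !                 ≤⟨ product-bound r 0 (+-identityʳ r) ⟩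
        k r * r ! * 1 * r ^ r       ≡⟨ rearrange (k r) (r !) (r ^ r) ⟩
        k r * r ^ r * r !           ∎)
        where
        open ≤-Reasoning
        rearrange : ∀ a x z → a * x * 1 * z ≡ a * z * x
        rearrange = solve-∀

      -- The step from r to α takes `ratio-bound` itself, because `growth` is empty at t = 0. Its
      -- coefficients combine to α n - r (α + n) = n - α r.
      independentSetCount-bound : (n ∸ α * r) * n ^ r ≤ α * α * k α * r ^ r
      independentSetCount-bound = begin
        u * n ^ r             ≤⟨ *-monoʳ-≤ u n^r≤k[r]r^r ⟩
        u * (k r * r ^ r)     ≡⟨ *-assoc u _ _ ⟨
        u * k r * r ^ r       ≤⟨ *-monoˡ-≤ (r ^ r) (last r refl) ⟩
        α * α * k α * r ^ r   ∎
        where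
        open ≤-Reasoning
        u = n ∸ α * r
        expand₁ : ∀ r u n a → r * (suc r + n) * a + u * a ≡ ((suc r * r + u) + r * n) * a
        expand₁ = solve-∀
        expand₂ : ∀ r n a → (n + r * n) * a ≡ suc r * n * a
        expand₂ = solve-∀
        expand₃ : ∀ α b d → α * (α * b) + d ≡ d + α * α * b
        expand₃ = solve-∀
        -- `ratio-bound` concerns k at a successor, so r must be exposed as one.
        last : ∀ r′ → r′ ≡ r → u * k r ≤ α * α * k α
        last zero    refl = contradiction refl (≢-nonZero⁻¹ 0)
        last (suc q) refl = +-cancelˡ-≤ (r * (α + n) * k r) _ _ (begin
          r * (α + n) * k r + u * k r           ≡⟨ expand₁ r u n (k r) ⟩
          ((α * r + u) + r * n) * k r           ≡⟨ cong (λ m → (m + r * n) * k r) (m+[n∸m]≡n large) ⟩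
          (n + r * n) * k r                     ≡⟨ expand₂ r n (k r) ⟩
          α * n * k r                           ≤⟨ ratio-bound α sparse q ⟩
          α * (α * k α) + r * (α + n) * k r     ≡⟨ expand₃ α (k α) (r * (α + n) * k r) ⟩
          r * (α + n) * k r + α * α * k α       ∎)

-- From the spectral radius to the degree sum.

module AverageDegree {c ℓ₁ ℓ₂ ℓ₃} (ℝ : RealField c ℓ₁ ℓ₂ ℓ₃) {n} (G : SimpleGraph n) where
  open RealField ℝ hiding (zero)
  open OrderedField ℝ
  open QuadraticForms ℝ
  open Spectrum ℝ
  open SimpleGraph G
  open IndependentSets using (χ; degreeSum)
  private
    module R = CommutativeRing commutativeRing
    module < = IsStrictPartialOrder isStrictPartialOrder
  open SemiringSum R.semiring using (sum; sum-cong-≋)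

  private
    A : Matrix ℝ n
    A = adjacencyMatrix ℝ G

    ones : ∀ {m} → Vector ℝ m
    ones _ = 1#

  adjacency-symmetric : IsSymmetric A
  adjacency-symmetric i j with i ∼? j | j ∼? i
  ... | yes _   | yes _   = refl
  ... | no _    | no _    = refl
  ... | yes i∼j | no j≁i  = contradiction (∼-sym i∼j) j≁i
  ... | no i≁j  | yes j∼i = contradiction (∼-sym j∼i) i≁j

  adjacency-isInteger : ∀ i j → IsInteger (A i j)
  adjacency-isInteger i j with does (i ∼? j)
  ... | true  = (1 , 0) , refl
  ... | false = (0 , 0) , refl

  fromℕ-sum : ∀ {m} (f : Fin m → ℕ) → fromℕ (ℕSum.sum f) ≈ sum (fromℕ ∘ f)
  fromℕ-sum {zero}  f = refl
  fromℕ-sum {suc m} f = trans (fromℕ-+ (f zero) _) (+-congˡ (fromℕ-sum (f ∘ suc)))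

  norm²-ones : ∀ m → norm² (ones {m}) ≈ fromℕ m
  norm²-ones zero    = refl
  norm²-ones (suc m) = +-cong (*-identityˡ 1#) (norm²-ones m)

  fromℕ-χ : ∀ i j → fromℕ (χ (i ∼? j)) ≈ A i j
  fromℕ-χ i j with does (i ∼? j)
  ... | true  = +-identityʳ 1#
  ... | false = refl

  form-ones : form A ones ≈ fromℕ (degreeSum G)
  form-ones = sym (begin
    fromℕ (ℕSum.sum (λ i → ℕSum.sum (λ j → χ (i ∼? j))))
      ≈⟨ fromℕ-sum (λ i → ℕSum.sum (λ j → χ (i ∼? j))) ⟩
    sum (λ i → fromℕ (ℕSum.sum (λ j → χ (i ∼? j))))
      ≈⟨ sum-cong-≋ (λ i → trans (fromℕ-sum (λ j → χ (i ∼? j)))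
           (trans (sum-cong-≋ λ j → trans (fromℕ-χ i j) (sym (*-identityʳ _))) (sym (*-identityˡ _)))) ⟩
    form A ones ∎)
    where open ≈-Reasoning R.setoid

  -- Equality with 0 is undecidable, but cotransitivity of 0 < norm² x at x₀² tells whether x₀² is
  -- positive or something positive remains in the tail.
  0<norm²⇒nonzero : ∀ {m} (x : Vector ℝ m) → 0# < norm² x → ∃[ i ] x i # 0#
  0<norm²⇒nonzero {zero}  x 0<N = contradiction 0<N <-irrefl
  0<norm²⇒nonzero {suc m} x 0<N with <-cotrans 0<N (x zero * x zero)
  ... | inj₁ 0<x² = let y , _ , xxy≈1 = inverse 0<x² in
    zero , Apartness.invertibleˡ⇒# heytingCommutativeRing (x zero * y , trans
      (solve 2 (λ x y → x :* y :* (x :- con (0 , 0)) := x :* x :* y) refl (x zero) y) xxy≈1)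
  ... | inj₂ x²<N = let i , xᵢ#0 = 0<norm²⇒nonzero (x ∘ suc) (<.<-respʳ-≈
                          (solve 2 (λ a b → (a :+ b) :- a := b) refl (x zero * x zero) (norm² (x ∘ suc)))
                          (<⇒0<- x²<N))
                    in suc i , xᵢ#0

  *-÷ : ∀ m d → fromℕ (suc d) * (m ÷ suc d) ≈ fromℕ m
  *-÷ m d = cancel _ (proj₁ (proj₂ (#⇒invertible (#-sym (<⇒# (0<fromℕ[1+n] d))))))
    where
    cancel : ∀ y → y * (fromℕ (suc d) - 0#) ≈ 1# → fromℕ (suc d) * (fromℕ m * y) ≈ fromℕ m
    cancel y y*[x-0]≈1 = trans
      (solve 3 (λ x m y → x :* (m :* y) := m :* (y :* (x :- con (0 , 0)))) refl (fromℕ (suc d)) (fromℕ m) y)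
      (trans (*-congˡ y*[x-0]≈1) (*-identityʳ _))

  -- From N² < α E ≤ α l N follows N < α l, while α ρ ≤ α D = N; hence ρ < l, and ρ ≥ 0 allows
  -- squaring. The summand `0# * 0#` is the squared imaginary part of a real eigenvalue.
  ρ²<λ² : ∀ {α E N D ρ l} → 0# < α → 0# < N → α * D ≈ N → 0# ≤ ρ → ρ ≤ D → E ≤ l * N →
    N * N < α * E → ρ * ρ < l * l + 0# * 0#
  ρ²<λ² {α} {E} {N} {D} {ρ} {l} 0<α 0<N αD≈N 0≤ρ ρ≤D E≤lN NN<αE = 0<-⇒< (<.<-respʳ-≈
    (solve 2 (λ l ρ → (l :- ρ) :* ((l :- ρ) :+ (ρ :+ ρ)) := (l :* l :+ con (0 , 0) :* con (0 , 0)) :- ρ :* ρ)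
      refl l ρ)
    (*-pos 0<l-ρ (pos+nonneg 0<l-ρ (nonneg+nonneg 0≤ρ 0≤ρ))))
    where
    0<αl-N : 0# < α * l - N
    0<αl-N = pos-cancelʳ 0<N (<.<-respʳ-≈
      (solve 4 (λ α E N l → (α :* E :- N :* N) :+ α :* (l :* N :- E) := (α :* l :- N) :* N) refl α E N l)
      (pos+nonneg (<⇒0<- NN<αE) (nonneg*nonneg (<⇒≤ 0<α) (≤⇒0≤- E≤lN))))
    0<l-ρ : 0# < l - ρ
    0<l-ρ = pos-cancelʳ 0<α (<.<-respʳ-≈
      (trans (+-congʳ (+-congˡ (-‿cong (sym αD≈N))))
        (solve 4 (λ α l D ρ → (α :* l :- α :* D) :+ α :* (D :- ρ) := (l :- ρ) :* α) refl α l D ρ))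
      (pos+nonneg 0<αl-N (nonneg*nonneg (<⇒≤ 0<α) (≤⇒0≤- ρ≤D))))

  -- Deciding the conclusion leaves ⊥ as the goal in the dense case, where the double-negated
  -- eigenvector may be used. Its eigenvalue λ₁ is at least the Rayleigh quotient of the all-ones
  -- vector, which contradicts `maximal`.
  degreeSum-bound : .{{_ : NonZero n}} → ∀ {ρ} → IsSpectralRadius ℝ A ρ → ∀ d →
    ρ ≤ n ÷ suc d → suc d ℕ.* degreeSum G ℕ.≤ n ℕ.* n
  degreeSum-bound {ρ} (0≤ρ , _ , maximal) d ρ≤n/α with suc d ℕ.* degreeSum G ℕ.≤? n ℕ.* n
  ... | yes sparse = sparse
  ... | no  dense  = ⊥-elim (¬¬eigenvector λ (x , 0<X , Ax≈λx) →
    maximal λ₁ 0#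
      ( x , (λ _ → 0#) , nonzero x 0<X
      , (λ i → trans (Ax≈λx i) (solve 1 (λ a → a := a :- con (0 , 0) :* con (0 , 0)) refl (λ₁ * x i)))
      , (λ i → trans (∙-zeroʳ (A i) (λ _ → refl))
          (solve 2 (λ l x → con (0 , 0) := l :* con (0 , 0) :+ con (0 , 0) :* x) refl λ₁ (x i))))
      λ₁-large)
    where
    0<n : 0# < fromℕ n
    0<n = fromℕ-mono-< {0} {n} (ℕ.>-nonZero⁻¹ n)
    0<N : 0# < norm² (ones {n})
    0<N = <.<-respʳ-≈ (sym (norm²-ones n)) 0<n
    open LargestEigenvalue A adjacency-symmetric adjacency-isInteger
      (ones , 0<N , ≤-resp refl (sym form-ones) (0≤fromℕ (degreeSum G)))
    nonzero : ∀ x → 0# < norm² x → ∃[ i ] (x i # 0# ⊎ 0# # 0#)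
    nonzero x 0<X = let i , xᵢ#0 = 0<norm²⇒nonzero x 0<X in i , inj₁ xᵢ#0
    λ₁-large : ρ * ρ < λ₁ * λ₁ + 0# * 0#
    λ₁-large = ρ²<λ² {fromℕ (suc d)} {fromℕ (degreeSum G)} {fromℕ n} {n ÷ suc d} {ρ} {λ₁}
      (0<fromℕ[1+n] d) 0<n (*-÷ n d) 0≤ρ ρ≤n/α
      (≤-resp form-ones (*-congˡ (norm²-ones n)) (form≤λ₁*norm² ones 0<N))
      (<-resp (fromℕ-* n n) (fromℕ-* (suc d) (degreeSum G)) (fromℕ-mono-< (ℕ.≰⇒> dense)))

-- Clearing denominators in the rational bound.

module LowerBound where
  open import Relation.Binary.PropositionalEquality
  open import Data.Integer.Base as ℤ using (+_)
  import Data.Integer.Properties as ℤ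
  open import Data.Rational.Base as ℚ using (ℚ; _/_; 1ℚ; toℚᵘ; Positive)
  import Data.Rational.Properties as ℚ
  open import Data.Rational.Solver using (module +-*-Solver)
  open import Data.Rational.Unnormalised.Base as ℚᵘ using (mkℚᵘ; *≡*; *≤*)
  import Data.Rational.Unnormalised.Properties as ℚᵘ

  ι : ℕ → ℚ
  ι m = + m / 1

  toℚᵘ-/ : ∀ a d → toℚᵘ (+ a / suc d) ℚᵘ.≃ mkℚᵘ (+ a) d
  toℚᵘ-/ a d = ℚ.toℚᵘ-fromℚᵘ (mkℚᵘ (+ a) d)

  /-*-ι : ∀ a d .{{_ : NonZero d}} → (+ a / d) ℚ.* ι d ≡ ι a
  /-*-ι a (suc d) = ℚ.toℚᵘ-injective (begin
    toℚᵘ ((+ a / suc d) ℚ.* ι (suc d))      ≈⟨ ℚ.toℚᵘ-homo-* (+ a / suc d) (ι (suc d)) ⟩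
    toℚᵘ (+ a / suc d) ℚᵘ.* toℚᵘ (ι (suc d)) ≈⟨ ℚᵘ.*-cong (toℚᵘ-/ a d) (toℚᵘ-/ (suc d) 0) ⟩
    mkℚᵘ (+ a) d ℚᵘ.* mkℚᵘ (+ suc d) 0      ≈⟨ *≡* (ℤ.*-assoc (+ a) (+ suc d) (+ 1)) ⟩
    mkℚᵘ (+ a) 0                            ≈⟨ toℚᵘ-/ a 0 ⟨
    toℚᵘ (ι a)                              ∎)
    where open ℚᵘ.≃-Reasoning

  ι-* : ∀ a b → ι (a ℕ.* b) ≡ ι a ℚ.* ι b
  ι-* a b = ℚ.toℚᵘ-injective (begin
    toℚᵘ (ι (a ℕ.* b))             ≈⟨ toℚᵘ-/ (a ℕ.* b) 0 ⟩
    mkℚᵘ (+ (a ℕ.* b)) 0           ≈⟨ *≡* (cong (ℤ._* + 1) (ℤ.pos-* a b)) ⟩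
    mkℚᵘ (+ a) 0 ℚᵘ.* mkℚᵘ (+ b) 0 ≈⟨ ℚᵘ.*-cong (toℚᵘ-/ a 0) (toℚᵘ-/ b 0) ⟨
    toℚᵘ (ι a) ℚᵘ.* toℚᵘ (ι b)     ≈⟨ ℚ.toℚᵘ-homo-* (ι a) (ι b) ⟨
    toℚᵘ (ι a ℚ.* ι b)             ∎)
    where open ℚᵘ.≃-Reasoning

  ι-+ : ∀ a b → ι (a ℕ.+ b) ≡ ι a ℚ.+ ι b
  ι-+ a b = ℚ.toℚᵘ-injective (begin
    toℚᵘ (ι (a ℕ.+ b))             ≈⟨ toℚᵘ-/ (a ℕ.+ b) 0 ⟩
    mkℚᵘ (+ (a ℕ.+ b)) 0
      ≈⟨ *≡* (cong (ℤ._* + 1) (cong₂ ℤ._+_ (sym (ℤ.*-identityʳ (+ a))) (sym (ℤ.*-identityʳ (+ b))))) ⟩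
    mkℚᵘ (+ a) 0 ℚᵘ.+ mkℚᵘ (+ b) 0 ≈⟨ ℚᵘ.+-cong (toℚᵘ-/ a 0) (toℚᵘ-/ b 0) ⟨
    toℚᵘ (ι a) ℚᵘ.+ toℚᵘ (ι b)     ≈⟨ ℚ.toℚᵘ-homo-+ (ι a) (ι b) ⟨
    toℚᵘ (ι a ℚ.+ ι b)             ∎)
    where open ℚᵘ.≃-Reasoning

  ι-mono : ∀ {a b} → a ℕ.≤ b → ι a ℚ.≤ ι b
  ι-mono {a} {b} a≤b = ℚ.toℚᵘ-cancel-≤ (begin
    toℚᵘ (ι a)   ≃⟨ toℚᵘ-/ a 0 ⟩
    mkℚᵘ (+ a) 0 ≤⟨ *≤* (ℤ.*-monoʳ-≤-nonNeg (+ 1) (ℤ.+≤+ a≤b)) ⟩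
    mkℚᵘ (+ b) 0 ≃⟨ toℚᵘ-/ b 0 ⟨
    toℚᵘ (ι b)   ∎)
    where open ℚᵘ.≤-Reasoning

  ι-^ : ∀ a b → ι (a ℕ.^ b) ≡ ι a ^ℚ b
  ι-^ a zero    = refl
  ι-^ a (suc b) = trans (ι-* a (a ℕ.^ b)) (cong (ι a ℚ.*_) (ι-^ a b))

  ^ℚ-*-distrib : ∀ x y m → (x ℚ.* y) ^ℚ m ≡ (x ^ℚ m) ℚ.* (y ^ℚ m)
  ^ℚ-*-distrib x y zero    = refl
  ^ℚ-*-distrib x y (suc m) = trans (cong ((x ℚ.* y) ℚ.*_) (^ℚ-*-distrib x y m))
    (solve 4 (λ x y a b → (x :* y) :* (a :* b) := (x :* a) :* (y :* b)) refl x y (x ^ℚ m) (y ^ℚ m))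
    where open +-*-Solver

  ι-pos : ∀ m .{{_ : NonZero m}} → Positive (ι m)
  ι-pos (suc m) = ℚ.normalize-pos (suc m) 1

  module _ (n q i : ℕ) .{{_ : NonZero n}} where
    private
      r α K M : ℕ
      r = suc q
      α = suc r
      K = α ℕ.* r ℕ.* n ℕ.* α ℕ.* r ℕ.^ α
      M = r ℕ.* q ℕ.* n ℕ.^ α

    -- `K` is the product of the denominators α r, n, α and r^α, and `lowerBound` times `K` equals
    -- (n - α r) M. The negative part is moved to the left because n - α r may be negative and both
    -- totals are to be images of naturals.
    lowerBound-*-K : (2≤α : 2 ℕ.≤ α) → lowerBound n α 2≤α ℚ.* ι K ℚ.+ ι (α ℕ.* r ℕ.* M) ≡ ι (n ℕ.* M)
    lowerBound-*-K 2≤α = begin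
      (x ℚ.- y) ℚ.* z ℚ.* w ^ℚ α ℚ.* ι K ℚ.+ ι (α ℕ.* r ℕ.* M)
        ≡⟨ cong₂ (λ a b → (x ℚ.- y) ℚ.* z ℚ.* w ^ℚ α ℚ.* a ℚ.+ b) ιK (ι-* (α ℕ.* r) M) ⟩
      (x ℚ.- y) ℚ.* z ℚ.* w ^ℚ α ℚ.* (A ℚ.* N ℚ.* ι α ℚ.* ι r ^ℚ α) ℚ.+ A ℚ.* ι M
        ≡⟨ solve 9 (λ x y z w A N B R M →
             (x :- y) :* z :* w :* (A :* N :* B :* R) :+ A :* M :=
             ((x :* A) :* N :- (y :* N) :* A) :* ((z :* B) :* (w :* R)) :+ A :* M)
             refl x y z (w ^ℚ α) A N (ι α) (ι r ^ℚ α) (ι M) ⟩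
      ((x ℚ.* A) ℚ.* N ℚ.- (y ℚ.* N) ℚ.* A) ℚ.* ((z ℚ.* ι α) ℚ.* (w ^ℚ α ℚ.* ι r ^ℚ α)) ℚ.+ A ℚ.* ι M
        ≡⟨ cong (ℚ._+ A ℚ.* ι M) (cong₂ ℚ._*_
             (cong₂ (λ a b → a ℚ.* N ℚ.- b ℚ.* A) (/-*-ι 1 (α ℕ.* r)) (/-*-ι 1 n))
             (cong₂ ℚ._*_ (/-*-ι (r ℕ.* q) α)
               (trans (sym (^ℚ-*-distrib w (ι r) α)) (cong (_^ℚ α) (/-*-ι n r))))) ⟩
      (1ℚ ℚ.* N ℚ.- 1ℚ ℚ.* A) ℚ.* (ι (r ℕ.* q) ℚ.* N ^ℚ α) ℚ.+ A ℚ.* ι M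
        ≡⟨ cong (λ m → (1ℚ ℚ.* N ℚ.- 1ℚ ℚ.* A) ℚ.* m ℚ.+ A ℚ.* ι M)
             (trans (cong (ι (r ℕ.* q) ℚ.*_) (sym (ι-^ n α))) (sym (ι-* (r ℕ.* q) (n ℕ.^ α)))) ⟩
      (1ℚ ℚ.* N ℚ.- 1ℚ ℚ.* A) ℚ.* ι M ℚ.+ A ℚ.* ι M
        ≡⟨ solve 3 (λ N A M → (con 1ℚ :* N :- con 1ℚ :* A) :* M :+ A :* M := N :* M) refl N A (ι M) ⟩
      N ℚ.* ι M
        ≡⟨ ι-* n M ⟨
      ι (n ℕ.* M) ∎
      where
      open ≡-Reasoning
      open +-*-Solver
      A N x y z w : ℚ
      A = ι (α ℕ.* r)
      N = ι n
      x = + 1 / (α ℕ.* r)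
      y = + 1 / n
      z = + (r ℕ.* q) / α
      w = + n / r
      ιK : ι K ≡ A ℚ.* N ℚ.* ι α ℚ.* ι r ^ℚ α
      ιK = trans (ι-* (α ℕ.* r ℕ.* n ℕ.* α) (r ℕ.^ α)) (cong₂ ℚ._*_
        (trans (ι-* (α ℕ.* r ℕ.* n) α) (cong (ℚ._* ι α) (ι-* (α ℕ.* r) n))) (ι-^ r α))

    -- Truncated subtraction serves both signs, as n ≤ α r + (n ∸ α r) always holds.
    clear-denominators : (n ℕ.∸ α ℕ.* r) ℕ.* n ℕ.^ r ℕ.≤ α ℕ.* α ℕ.* i ℕ.* r ℕ.^ r →
      n ℕ.* M ℕ.≤ i ℕ.* K ℕ.+ α ℕ.* r ℕ.* M
    clear-denominators bound = begin
        n ℕ.* M                                         ≤⟨ ℕ.*-monoˡ-≤ M (ℕ.m≤n+m∸n n (α ℕ.* r)) ⟩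
        (α ℕ.* r ℕ.+ u) ℕ.* M                           ≡⟨ ℕ.*-distribʳ-+ M (α ℕ.* r) u ⟩
        α ℕ.* r ℕ.* M ℕ.+ u ℕ.* M                       ≡⟨ ℕ.+-comm (α ℕ.* r ℕ.* M) _ ⟩
        u ℕ.* M ℕ.+ α ℕ.* r ℕ.* M                       ≤⟨ ℕ.+-monoˡ-≤ (α ℕ.* r ℕ.* M) (begin
          u ℕ.* M                                       ≡⟨ rearrange₁ u q n (n ℕ.^ r) ⟩
          -- Replacing q = α - 2 by r = α - 1 is where the counting bound has room to spare.
          r ℕ.* q ℕ.* n ℕ.* (u ℕ.* n ℕ.^ r)             ≤⟨ ℕ.*-mono-≤ (ℕ.*-monoˡ-≤ n (ℕ.*-monoʳ-≤ r (ℕ.n≤1+n q))) bound ⟩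
          r ℕ.* r ℕ.* n ℕ.* (α ℕ.* α ℕ.* i ℕ.* r ℕ.^ r) ≡⟨ rearrange₂ α i q n (r ℕ.^ r) ⟩
          i ℕ.* K                                       ∎) ⟩
        i ℕ.* K ℕ.+ α ℕ.* r ℕ.* M                       ∎
      where
      open ℕ.≤-Reasoning
      u = n ℕ.∸ α ℕ.* r
      rearrange₁ : ∀ u q n N → u ℕ.* (suc q ℕ.* q ℕ.* (n ℕ.* N)) ≡ suc q ℕ.* q ℕ.* n ℕ.* (u ℕ.* N)
      rearrange₁ = solve-∀
      rearrange₂ : ∀ α i q n R → suc q ℕ.* suc q ℕ.* n ℕ.* (α ℕ.* α ℕ.* i ℕ.* R)
        ≡ i ℕ.* (α ℕ.* suc q ℕ.* n ℕ.* α ℕ.* (suc q ℕ.* R))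
      rearrange₂ = solve-∀

    lowerBound≤ : (2≤α : 2 ℕ.≤ α) →
      (n ℕ.∸ α ℕ.* r) ℕ.* n ℕ.^ r ℕ.≤ α ℕ.* α ℕ.* i ℕ.* r ℕ.^ r →
      lowerBound n α 2≤α ℚ.≤ ι i
    lowerBound≤ 2≤α bound = ℚ.*-cancelʳ-≤-pos (ι K) {{ι-pos K {{K≢0}}}} (+-cancelʳ-≤ (ι (α ℕ.* r ℕ.* M)) (begin
      lowerBound n α 2≤α ℚ.* ι K ℚ.+ ι (α ℕ.* r ℕ.* M) ≡⟨ lowerBound-*-K 2≤α ⟩
      ι (n ℕ.* M)                                      ≤⟨ ι-mono bound′ ⟩
      ι (i ℕ.* K ℕ.+ α ℕ.* r ℕ.* M)                    ≡⟨ ι-+ (i ℕ.* K) (α ℕ.* r ℕ.* M) ⟩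
      ι (i ℕ.* K) ℚ.+ ι (α ℕ.* r ℕ.* M)                ≡⟨ cong (ℚ._+ ι (α ℕ.* r ℕ.* M)) (ι-* i K) ⟩
      ι i ℚ.* ι K ℚ.+ ι (α ℕ.* r ℕ.* M)                ∎))
      where
      open ℚ.≤-Reasoning
      +-cancelʳ-≤ : ∀ z {x y} → x ℚ.+ z ℚ.≤ y ℚ.+ z → x ℚ.≤ y
      +-cancelʳ-≤ z {x} {y} p = subst₂ ℚ._≤_ (cancel x) (cancel y) (ℚ.+-monoˡ-≤ (ℚ.- z) p)
        where
        cancel : ∀ x → x ℚ.+ z ℚ.+ (ℚ.- z) ≡ x
        cancel x = trans (ℚ.+-assoc x z (ℚ.- z))
          (trans (cong (x ℚ.+_) (ℚ.+-inverseʳ z)) (ℚ.+-identityʳ x))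
      K≢0 : NonZero K
      K≢0 = ℕ.m*n≢0 (α ℕ.* r ℕ.* n ℕ.* α) (r ℕ.^ α)
        {{ℕ.m*n≢0 (α ℕ.* r ℕ.* n) α {{ℕ.m*n≢0 (α ℕ.* r) n}}}} {{ℕ.m^n≢0 r α}}
      bound′ : n ℕ.* M ℕ.≤ i ℕ.* K ℕ.+ α ℕ.* r ℕ.* M
      bound′ = clear-denominators bound

open import Data.Integer.Base using (+_)
open import Data.Nat.Base using (_≤_)
open import Data.Rational.Base as ℚ using (_/_)

theorem2p4 : ∀ {c ℓ₁ ℓ₂ ℓ₃} (ℝ : RealField c ℓ₁ ℓ₂ ℓ₃)
    (n : ℕ) .{{_ : NonZero n}} (G : SimpleGraph n) (α : ℕ) (2≤α : 2 ≤ α)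
    (ρ : RealField.Carrier ℝ) → IsSpectralRadius ℝ (adjacencyMatrix ℝ G) ρ →
    RealField._≤_ ℝ ρ (RealField._÷_ ℝ n α {{2≤α⇒α≢0 2≤α}}) →
    (+ independentSetCount G α / 1) ℚ.≥ lowerBound n α 2≤α
theorem2p4 ℝ n G (suc (suc q)) 2≤α@(ℕ.s≤s (ℕ.s≤s _)) ρ isρ ρ≤n/α =
  LowerBound.lowerBound≤ n q (independentSetCount G (suc r)) 2≤α bound
  where
  r = suc q
  sparse : suc r ℕ.* IndependentSets.degreeSum G ℕ.≤ n ℕ.* n
  sparse = AverageDegree.degreeSum-bound ℝ G isρ r ρ≤n/α
  bound : (n ℕ.∸ suc r ℕ.* r) ℕ.* n ℕ.^ r ℕ.≤ suc r ℕ.* suc r ℕ.* independentSetCount G (suc r) ℕ.* r ℕ.^ r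
  bound with suc r ℕ.* r ℕ.≤? n
  ... | yes large = IndependentSets.independentSetCount-bound G r large sparse
  -- Here the truncated difference is 0, so the left side vanishes.
  ... | no  small = ℕ.≤-trans (ℕ.≤-reflexive (≡.cong (ℕ._* n ℕ.^ r) (ℕ.m≤n⇒m∸n≡0 (ℕ.≰⇒≥ small)))) ℕ.z≤n
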